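{- For integers $\nu\ge1$ and $n>\nu(2\nu+3)$, \[ (-1)^\nu\left(\sum_{\tau=0}^{\nu}(-1)^\tau p_o\big(2n+1-\tau(2\tau+1)\big)-\sum_{\tau=0}^{\nu-1}(-1)^\tau p_o\big(2n+1-(\tau+1)(2\tau+1)\big)\right)=p_o(3,4,\nu;2n+1)+p_o(1,4,\nu;2n+1). \]
   Context: $p_o(n)$ is the number of partitions of $n$ into odd parts. Definition of $M(a,m,\nu;n)$ (integers $\nu\ge0$, $1\le a<m$, $n\ge0$): for a partition $\lambda_1\ge\dots\ge\lambda_k$ of $n$ into parts $\equiv a\pmod m$, put $\ell_i=(\lambda_i-a)/m+1$ (number of boxes of the row of $\lambda_i$ in the $m$-modular Young diagram), and let $t$ be the largest integer $0\le t\le k$ with $\ell_t\ge t+\nu+2$ (height of the $(\nu+2)$-Durfee rectangle, of width $t+\nu+2$). $M(a,m,\nu;n)$ counts partitions of $n$ into parts $\equiv a\pmod m$ in which each of $a,a+m,\dots,a+m\nu$ occurs at least once and $\ell_i<t+\nu+2$ for all $i>t$. Definition: for $a\in\{1,3\}$, $p_o(a,4,\nu;n)$ counts partitions of $n$ into odd parts such that, if $\alpha$ is the sum of the parts $\not\equiv a\pmod 4$, the parts $\equiv a\pmod 4$ form a partition counted by $M(a,4,\nu;n-\alpha)$. -}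

module Defs where

open import Data.Bool using (Bool; true; false; _∧_; _∨_; not; if_then_else_)
open import Data.Nat using (ℕ; zero; suc; _+_; _*_; _∸_; _⊓_; _⊔_; _≡ᵇ_; _≤ᵇ_; _<ᵇ_; NonZero)
open import Data.Nat.DivMod using (_/_; _%_)
open import Data.List using (List; []; _∷_; map; concatMap; length; filterᵇ; upTo; zip)
open import Data.Bool.ListAction using (and; or)
open import Data.Integer as ℤ using (ℤ)
open import Data.Product using (_×_; _,_)

from1 : ℕ → List ℕ
from1 k = map suc (upTo k)

-- partsF fuel rem mx : all weakly decreasing lists of positive parts,
-- each part ≤ mx, summing to rem (fuel ≥ rem guarantees completeness).
partsF : ℕ → ℕ → ℕ → List (List ℕ)
partsF zero    zero      mx = [] ∷ []
partsF zero    (suc _)   mx = []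
partsF (suc f) zero      mx = [] ∷ []
partsF (suc f) (suc r)   mx =
  concatMap (λ k → map (k ∷_) (partsF f (suc r ∸ k) k)) (from1 (suc r ⊓ mx))

partitions : ℕ → List (List ℕ)
partitions n = partsF n n n

isOdd : ℕ → Bool
isOdd x = x % 2 ≡ᵇ 1

allOdd : List ℕ → Bool
allOdd λs = and (map isOdd λs)

p-o : ℕ → ℕ
p-o n = length (filterᵇ allOdd (partitions n))

-- ℓ = (λ - a)/m + 1, number of boxes in the m-modular diagram row
ell : (a m : ℕ) .{{_ : NonZero m}} → ℕ → ℕ
ell a m x = (x ∸ a) / m + 1

indexed : {A : Set} → List A → List (ℕ × A)
indexed xs = zip (from1 (length xs)) xs

-- t = largest t (0 ≤ t ≤ k) with ℓ_t ≥ t + ν + 2 (t = 0 always allowed)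
durfeeT : ℕ → List ℕ → ℕ
durfeeT ν ℓs = go (indexed ℓs)
  where
  go : List (ℕ × ℕ) → ℕ
  go [] = 0
  go ((i , l) ∷ rest) = (if (i + ν + 2) ≤ᵇ l then i else 0) ⊔ go rest

belowRect : ℕ → List ℕ → Bool
belowRect ν ℓs =
  and (map (λ { (i , l) → not (t <ᵇ i) ∨ (l <ᵇ t + ν + 2) }) (indexed ℓs))
  where t = durfeeT ν ℓs

elemᵇ : ℕ → List ℕ → Bool
elemᵇ x ys = or (map (x ≡ᵇ_) ys)

allCong : (a m : ℕ) .{{_ : NonZero m}} → List ℕ → Bool
allCong a m λs = and (map (λ x → x % m ≡ᵇ a % m) λs)

isM : (a m ν : ℕ) .{{_ : NonZero m}} → List ℕ → Bool
isM a m ν λs =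
  allCong a m λs
  ∧ and (map (λ j → elemᵇ (a + m * j) λs) (upTo (suc ν)))
  ∧ belowRect ν (map (ell a m) λs)

M : (a m ν : ℕ) .{{_ : NonZero m}} → ℕ → ℕ
M a m ν n = length (filterᵇ (isM a m ν) (partitions n))

isPo : (a ν : ℕ) → List ℕ → Bool
isPo a ν λs = allOdd λs ∧ isM a 4 ν (filterᵇ (λ x → x % 4 ≡ᵇ a) λs)

p-o-a : (a ν : ℕ) → ℕ → ℕ
p-o-a a ν n = length (filterᵇ (isPo a ν) (partitions n))

sumℤ : ℕ → (ℕ → ℤ) → ℤ
sumℤ zero    f = f 0
sumℤ (suc N) f = sumℤ N f ℤ.+ f (suc N)

sgn : ℕ → ℤ
sgn zero = ℤ.+ 1
sgn (suc k) = ℤ.- sgn k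

{-# OPTIONS --safe #-}
-- Let E(ν) be the right-hand side and L(ν) the left-hand side, N = 2n + 1.
--
-- In terms of rows, the rectangle condition of M(a,4,ν) says that ℓᵢ ≠ i + ν + 1 for all i.
-- If a partition containing a, …, a + 4ν violates it at the row i = t + 1, lengthen the first
-- t rows by one box and replace the row of t + ν + 2 boxes by one of ν + 2 boxes.  The result
-- contains a + 4(ν + 1) as well and satisfies the condition for ν + 1, and this is a bijection.
-- Hence E(ν) + E(ν + 1) = p_o(N - (ν + 1)(2ν + 3)) + p_o(N - (ν + 1)(2ν + 1)).  As L satisfies
-- the same recurrence and E(ν) = 0 for large ν, it remains to see that L(ν) = 0 for large ν,
-- that is, Σ (-1)^j p_o(N - j(2j + 1)) = 0 over all integers j.
--
-- Let r(e,n) (excessCount) count the partitions into odd parts in which the parts 4i + 1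
-- outnumber the parts 4i + 3 by e and Σ ⌊(x + 1)/4⌋ = n; they are partitions of e + 4n.  Exchanging 4i + 1 and
-- 4i + 3 gives r(-e,n) = r(e,n - e).  Removing parts 1 and exchanging 4i - 1 and 4i + 1 shows
-- that r(e,n) + r(-e-1,n) does not depend on e.  As j(j + 1)/2 is invariant under j ↦ -1 - j, it
-- follows that t(d,n) = Σ (-1)^j r(d + j, n - j(j + 1)/2) equals t(d,n - d), so t(d,n) = 0 for
-- d ≠ 0.  The alternating sum above is the sum of t(N - 4m,m) over m, and N - 4m ≠ 0 for odd N.
module Submission where

open import Data.Bool using (true; false; T; if_then_else_; _∨_; not)
open import Data.Bool.Properties using (T-∧; T-∨; T-not-≡)
open import Data.Integer as ℤ using (ℤ; +_; -[1+_])
open import Data.Integer.Properties as ℤ using ()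
open import Data.Integer.Tactic.RingSolver using (solve-∀)
open import Data.List using (List; []; _∷_; _++_; map; length; filter; upTo; applyUpTo; zip)
open import Data.List.Membership.Propositional using (_∈_; _∉_; find; lose)
open import Data.List.Membership.Propositional.Properties
open import Data.List.Properties using (length-++; map-upTo; filter-++; filter-all; filter-none; ++-identityʳ)
open import Data.List.Relation.Binary.Permutation.Propositional using (_↭_; ↭-refl; ↭-sym; ↭-trans; ↭-reflexive; prep; swap; ↭⇒↭ₛ)
open import Data.List.Relation.Binary.Permutation.Propositional.Properties as Perm using (∈-resp-↭; All-resp-↭; drop-∷; filter-↭)
open import Data.List.Relation.Binary.Pointwise using (Pointwise-≡⇒≡)
open import Data.List.Relation.Unary.All as All using (All; []; _∷_)
open import Data.List.Relation.Unary.AllPairs as AllPairs using (AllPairs; []; _∷_)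
open import Data.List.Relation.Unary.Any as Any using (here; there)
open import Data.List.Relation.Unary.Sorted.TotalOrder.Properties using (↗↭↗⇒≋)
open import Data.List.Relation.Unary.Unique.Propositional using (Unique)
open import Data.Nat as ℕ using (ℕ; zero; suc; _+_; _*_; _∸_; _⊓_; _⊔_; _≤_; _<_; _≥_; z≤n; s≤s; _≡ᵇ_; _≤ᵇ_; _<ᵇ_)
open import Data.Nat.DivMod using (_/_; _%_; m≡m%n+[m/n]*n; [m+kn]%n≡m%n; m*n/n≡m; /-monoˡ-≤)
open import Data.Nat.ListAction using (sum)
open import Data.Nat.ListAction.Properties using (sum-↭; sum-++)
open import Data.Nat.Properties as ℕ using ()
open import Data.Product using (_×_; _,_; proj₁; proj₂)
open import Data.Sum using (_⊎_; inj₁; inj₂)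
open import Data.Unit using (⊤; tt)
open import Defs
open import Function using (_∘_; id; flip)
open import Function.Bundles using (Equivalence)
open import Level using (0ℓ)
open import Relation.Binary.PropositionalEquality using (_≡_; _≢_; refl; sym; trans; cong; cong₂; subst; subst₂; module ≡-Reasoning)
open import Relation.Nullary using (¬_; yes; no; does; contradiction)
open import Relation.Nullary.Decidable using (_×-dec_; ¬?; T?)
open import Relation.Unary using (Pred; Decidable)
open import Data.List.Membership.DecPropositional ℕ._≟_ using (_∈?_)
open import Algebra.Properties.AbelianGroup ℤ.+-0-abelianGroup using () renaming (∙-cancelʳ to +-cancelʳ)
import Data.List.Relation.Unary.All.Properties as All
import Data.List.Relation.Unary.AllPairs.Properties as AllPairs
import Data.List.Relation.Unary.Any.Properties as Any
import Data.List.Relation.Unary.Linked.Properties as Linked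
import Data.List.Relation.Unary.Unique.Propositional.Properties as Unique
import Data.List.Sort as Sort
import Data.Nat.Tactic.RingSolver as ℕ-Solver
import Relation.Binary.Construct.Flip.EqAndOrd as Flip

-- Counting partitions

Desc : List ℕ → Set
Desc = AllPairs _≥_

≥-order = Flip.decTotalOrder ℕ.≤-decTotalOrder

open Sort ≥-order using (sort; sort-↭; sort-↗)

sort-desc : ∀ xs → Desc (sort xs)
sort-desc xs = Linked.Linked⇒AllPairs (flip ℕ.≤-trans) (sort-↗ xs)

-- Equalities of partitions can thereby be checked on multisets, which is how the maps below are
-- shown to be mutually inverse.
desc-↭⇒≡ : ∀ {xs ys} → Desc xs → Desc ys → xs ↭ ys → xs ≡ ys
desc-↭⇒≡ dx dy p = Pointwise-≡⇒≡
  (↗↭↗⇒≋ (Flip.totalOrder ℕ.≤-totalOrder) (Linked.AllPairs⇒Linked dx) (Linked.AllPairs⇒Linked dy) (↭⇒↭ₛ p))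

IsPartition : ℤ → Pred (List ℕ) 0ℓ
IsPartition N xs = Desc xs × All (0 <_) xs × + sum xs ≡ N

-- Sizes are integers so that N - j(2j + 1) makes sense for every j; a negative size has no
-- partitions.
partitionsℤ : ℤ → List (List ℕ)
partitionsℤ (+ n)    = partitions n
partitionsℤ -[1+ _ ] = []

∈-partsF⁻ : ∀ f r mx {xs} → xs ∈ partsF f r mx →
            Desc xs × All (0 <_) xs × All (_≤ mx) xs × sum xs ≡ r
∈-partsF⁻ zero    zero    mx (here refl) = [] , [] , [] , refl
∈-partsF⁻ (suc f) zero    mx (here refl) = [] , [] , [] , refl
∈-partsF⁻ (suc f) (suc r) mx xs∈ with find (∈-concatMap⁻ _ {xs = from1 (suc r ⊓ mx)} xs∈)
... | k , k∈ , xs∈′ with ∈-map⁻ suc k∈ | ∈-map⁻ (k ∷_) xs∈′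
... | j , j∈ , refl | ys , ys∈ , refl with ∈-partsF⁻ f (suc r ∸ suc j) (suc j) ys∈
... | desc , pos , bnd , eq = bnd ∷ desc , s≤s z≤n ∷ pos
    , k≤mx ∷ All.map (λ y≤k → ℕ.≤-trans y≤k k≤mx) bnd
    , trans (cong (suc j ℕ.+_) eq) (ℕ.m+[n∸m]≡n k≤r)
  where
  k≤ : suc j ≤ suc r ⊓ mx
  k≤ = ∈-upTo⁻ j∈
  k≤mx = ℕ.≤-trans k≤ (ℕ.m⊓n≤n (suc r) mx)
  k≤r  = ℕ.≤-trans k≤ (ℕ.m⊓n≤m (suc r) mx)

-- A positive part lowers the remainder by at least one while one unit of fuel is spent, so `r ≤ f`
-- persists.
∈-partsF⁺ : ∀ f r mx {xs} → r ≤ f → Desc xs → All (0 <_) xs → All (_≤ mx) xs → sum xs ≡ r →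
            xs ∈ partsF f r mx
∈-partsF⁺ zero    zero    mx {[]}         _ _ _ _ _ = here refl
∈-partsF⁺ (suc f) zero    mx {[]}         _ _ _ _ _ = here refl
∈-partsF⁺ zero    zero    mx {suc _ ∷ _}  _ _ _ _ ()
∈-partsF⁺ (suc f) zero    mx {suc _ ∷ _}  _ _ _ _ ()
∈-partsF⁺ zero    zero    mx {zero ∷ _}  _ _ (() ∷ _)
∈-partsF⁺ (suc f) _       mx {zero ∷ _}  _ _ (() ∷ _)
∈-partsF⁺ zero    (suc r) mx              () _ _ _ _
∈-partsF⁺ (suc f) (suc r) mx {[]}         _ _ _ _ ()
∈-partsF⁺ (suc f) (suc r) mx {suc j ∷ ys} (s≤s r≤f) (y≤ ∷ desc) (_ ∷ pos) (k≤mx ∷ _) eq =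
  ∈-concatMap⁺ _ (lose (∈-map⁺ suc (∈-upTo⁺ (ℕ.⊓-glb k≤r k≤mx)))
    (∈-map⁺ (suc j ∷_) (∈-partsF⁺ f (r ∸ j) (suc j) (ℕ.≤-trans (ℕ.m∸n≤m r j) r≤f) desc pos y≤ sum-ys)))
  where
  k≤r : suc j ≤ suc r
  k≤r = subst (suc j ≤_) eq (ℕ.m≤m+n (suc j) (sum ys))
  sum-ys : sum ys ≡ r ∸ j
  sum-ys = trans (sym (ℕ.m+n∸m≡n j (sum ys))) (cong (_∸ j) (ℕ.suc-injective eq))

partsF-unique : ∀ f r mx → Unique (partsF f r mx)
partsF-unique zero    zero    mx = [] ∷ []
partsF-unique zero    (suc r) mx = []
partsF-unique (suc f) zero    mx = [] ∷ []
partsF-unique (suc f) (suc r) mx = Unique.concat⁺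
  (All.map⁺ (All.tabulate λ {k} _ → Unique.map⁺ (λ { refl → refl }) (partsF-unique f (suc r ∸ k) k)))
  (AllPairs.map⁺ (AllPairs.map disjoint (Unique.map⁺ ℕ.suc-injective (Unique.upTo⁺ (suc r ⊓ mx)))))
  where
  disjoint : ∀ {k l} → k ≢ l → ∀ {xs} →
    ¬ (xs ∈ map (k ∷_) (partsF f (suc r ∸ k) k) × xs ∈ map (l ∷_) (partsF f (suc r ∸ l) l))
  disjoint k≢l (p , q) with ∈-map⁻ _ p | ∈-map⁻ _ q
  ... | _ , _ , refl | _ , _ , refl = k≢l refl

∈-partitionsℤ⁻ : ∀ N {xs} → xs ∈ partitionsℤ N → IsPartition N xs
∈-partitionsℤ⁻ (+ n) xs∈ with ∈-partsF⁻ n n n xs∈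
... | desc , pos , _ , eq = desc , pos , cong +_ eq

∈⇒≤sum : ∀ {x xs} → x ∈ xs → x ≤ sum xs
∈⇒≤sum {xs = y ∷ ys} (here refl) = ℕ.m≤m+n y (sum ys)
∈⇒≤sum {xs = y ∷ ys} (there x∈)  = ℕ.≤-trans (∈⇒≤sum x∈) (ℕ.m≤n+m (sum ys) y)

∈-partitionsℤ⁺ : ∀ N {xs} → IsPartition N xs → xs ∈ partitionsℤ N
∈-partitionsℤ⁺ _ {xs} (desc , pos , refl) =
  ∈-partsF⁺ (sum xs) (sum xs) (sum xs) ℕ.≤-refl desc pos (All.tabulate ∈⇒≤sum) refl

partitionsℤ-unique : ∀ N → Unique (partitionsℤ N)
partitionsℤ-unique (+ n)    = partsF-unique n n n
partitionsℤ-unique -[1+ _ ] = []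

-- Counting by bijections

count : {P : Pred (List ℕ) 0ℓ} → Decidable P → ℤ → ℕ
count P? N = length (filter P? (partitionsℤ N))

-- Induction on `xs`: one occurrence of `f x` is cut out of `ys`, and by injectivity the remaining
-- elements still land in what is left.
injection⇒length≤ : ∀ {A B : Set} {xs : List A} {ys : List B} (f : A → B) → Unique xs →
  (∀ {x} → x ∈ xs → f x ∈ ys) → (∀ {x x′} → x ∈ xs → x′ ∈ xs → f x ≡ f x′ → x ≡ x′) →
  length xs ≤ length ys
injection⇒length≤ {xs = []} f _ _ _ = z≤n
injection⇒length≤ {xs = x ∷ xs} {ys} f (x∉ ∷ uniq) f∈ inj with ∈-∃++ (f∈ (here refl))
... | as , bs , refl = subst (suc (length xs) ≤_) len
  (s≤s (injection⇒length≤ f uniq f∈′ (λ p q → inj (there p) (there q))))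
  where
  len : suc (length (as ++ bs)) ≡ length (as ++ f x ∷ bs)
  len = trans (cong suc (length-++ as)) (trans (sym (ℕ.+-suc (length as) (length bs))) (sym (length-++ as)))
  f∈′ : ∀ {x′} → x′ ∈ xs → f x′ ∈ as ++ bs
  f∈′ {x′} x′∈ with ∈-++⁻ as (f∈ (there x′∈))
  ... | inj₁ p            = ∈-++⁺ˡ p
  ... | inj₂ (there p)    = ∈-++⁺ʳ as p
  ... | inj₂ (here fx′≡fx) = contradiction (sym (inj (there x′∈) (here refl) fx′≡fx)) (All.lookup x∉ x′∈)

module _ {P Q : Pred (List ℕ) 0ℓ} (P? : Decidable P) (Q? : Decidable Q) where

  count-≤ : ∀ {N M} (f g : List ℕ → List ℕ) →
    (∀ {xs} → IsPartition N xs → P xs → IsPartition M (f xs) × Q (f xs) × g (f xs) ≡ xs) →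
    count P? N ≤ count Q? M
  count-≤ {N} {M} f g ok = injection⇒length≤ f (Unique.filter⁺ P? (partitionsℤ-unique N)) f∈ f-inj
    where
    split : ∀ {xs} → xs ∈ filter P? (partitionsℤ N) → IsPartition M (f xs) × Q (f xs) × g (f xs) ≡ xs
    split xs∈ with ∈-filter⁻ P? {xs = partitionsℤ N} xs∈
    ... | xs∈′ , Pxs = ok (∈-partitionsℤ⁻ N xs∈′) Pxs
    f∈ : ∀ {xs} → xs ∈ filter P? (partitionsℤ N) → f xs ∈ filter Q? (partitionsℤ M)
    f∈ xs∈ = let (part , Qf , _) = split xs∈ in ∈-filter⁺ Q? (∈-partitionsℤ⁺ M part) Qf
    f-inj : ∀ {xs ys} → xs ∈ filter P? (partitionsℤ N) → ys ∈ filter P? (partitionsℤ N) → f xs ≡ f ys → xs ≡ ys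
    f-inj xs∈ ys∈ eq =
      trans (sym (proj₂ (proj₂ (split xs∈)))) (trans (cong g eq) (proj₂ (proj₂ (split ys∈))))

module _ {P Q : Pred (List ℕ) 0ℓ} (P? : Decidable P) (Q? : Decidable Q) where

  count-bijection : ∀ {N M} (f g : List ℕ → List ℕ) →
    (∀ {xs} → IsPartition N xs → P xs → IsPartition M (f xs) × Q (f xs) × g (f xs) ≡ xs) →
    (∀ {xs} → IsPartition M xs → Q xs → IsPartition N (g xs) × P (g xs) × f (g xs) ≡ xs) →
    count P? N ≡ count Q? M
  count-bijection f g f-ok g-ok = ℕ.≤-antisym (count-≤ P? Q? f g f-ok) (count-≤ Q? P? g f g-ok)

  count-cong : ∀ {N} → (∀ {xs} → IsPartition N xs → P xs → Q xs) →
    (∀ {xs} → IsPartition N xs → Q xs → P xs) → count P? N ≡ count Q? N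
  count-cong imp imp′ = count-bijection id id (λ part p → part , imp part p , refl) (λ part q → part , imp′ part q , refl)

  -- For maps that ignore order. Sorting turns their values into partitions and comes between the
  -- two maps, hence the inverse laws are required for every rearrangement `ys` of the image.
  count-multiset-bijection : ∀ {N M} (f g : List ℕ → List ℕ) →
    (∀ {xs ys} → xs ↭ ys → P xs → P ys) → (∀ {xs ys} → xs ↭ ys → Q xs → Q ys) →
    (∀ {xs} → All (0 <_) xs → + sum xs ≡ N → P xs →
      All (0 <_) (f xs) × + sum (f xs) ≡ M × Q (f xs) × (∀ {ys} → ys ↭ f xs → g ys ↭ xs)) →
    (∀ {xs} → All (0 <_) xs → + sum xs ≡ M → Q xs →
      All (0 <_) (g xs) × + sum (g xs) ≡ N × P (g xs) × (∀ {ys} → ys ↭ g xs → f ys ↭ xs)) →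
    count P? N ≡ count Q? M
  count-multiset-bijection {N} {M} f g P-resp Q-resp f-ok g-ok =
    count-bijection (sort ∘ f) (sort ∘ g)
      (λ { (desc , pos , s) p → let (pos′ , s′ , q , inv) = f-ok pos s p in
           sorted pos′ s′ , Q-resp (↭-sym (sort-↭ _)) q
           , desc-↭⇒≡ (sort-desc _) desc (↭-trans (sort-↭ _) (inv (sort-↭ _))) })
      (λ { (desc , pos , s) q → let (pos′ , s′ , p , inv) = g-ok pos s q in
           sorted pos′ s′ , P-resp (↭-sym (sort-↭ _)) p
           , desc-↭⇒≡ (sort-desc _) desc (↭-trans (sort-↭ _) (inv (sort-↭ _))) })
    where
    sorted : ∀ {K xs} → All (0 <_) xs → + sum xs ≡ K → IsPartition K (sort xs)
    sorted {xs = xs} pos s = sort-desc xs , All-resp-↭ (↭-sym (sort-↭ xs)) pos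
                           , trans (cong +_ (sum-↭ (sort-↭ xs))) s

  count-split : ∀ N → count P? N ≡ count (λ xs → P? xs ×-dec Q? xs) N + count (λ xs → P? xs ×-dec ¬? (Q? xs)) N
  count-split N = go (partitionsℤ N)
    where
    go : ∀ xss → length (filter P? xss) ≡ length (filter (λ xs → P? xs ×-dec Q? xs) xss)
                                        + length (filter (λ xs → P? xs ×-dec ¬? (Q? xs)) xss)
    go [] = refl
    go (xs ∷ xss) with does (P? xs) | does (Q? xs)
    ... | false | _     = go xss
    ... | true  | true  = cong suc (go xss)
    ... | true  | false = trans (cong suc (go xss)) (sym (ℕ.+-suc _ _))

count-zero : ∀ {P : Pred (List ℕ) 0ℓ} (P? : Decidable P) {N} →
  (∀ {xs} → IsPartition N xs → ¬ P xs) → count P? N ≡ 0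
count-zero P? {N} none with filter P? (partitionsℤ N) | (λ {xs} → ∈-filter⁻ P? {xs} {partitionsℤ N})
... | []    | _ = refl
... | _ ∷ _ | mem = let (xs∈ , p) = mem (here refl) in contradiction p (none (∈-partitionsℤ⁻ N xs∈))

delete : ℕ → List ℕ → List ℕ
delete s []       = []
delete s (x ∷ xs) with x ℕ.≟ s
... | yes _ = xs
... | no  _ = x ∷ delete s xs

delete-↭ : ∀ {s xs} → s ∈ xs → s ∷ delete s xs ↭ xs
delete-↭ {s} {x ∷ xs} s∈ with x ℕ.≟ s
... | yes refl = ↭-refl
delete-↭ {s} {x ∷ xs} (here refl) | no x≢s = contradiction refl x≢s
delete-↭ {s} {x ∷ xs} (there s∈)  | no x≢s = ↭-trans (swap s x ↭-refl) (prep x (delete-↭ s∈))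

∷-↭⇒delete-↭ : ∀ {s xs ys} → ys ↭ s ∷ xs → delete s ys ↭ xs
∷-↭⇒delete-↭ ys↭ = drop-∷ (↭-trans (delete-↭ (∈-resp-↭ (↭-sym ys↭) (here refl))) ys↭)

All-delete : ∀ {P : Pred ℕ 0ℓ} {s} xs → All P xs → All P (delete s xs)
All-delete []       [] = []
All-delete {s = s} (x ∷ xs) (px ∷ pxs) with x ℕ.≟ s
... | yes _ = pxs
... | no  _ = px ∷ All-delete xs pxs

delete-desc : ∀ {s} xs → Desc xs → Desc (delete s xs)
delete-desc [] [] = []
delete-desc {s} (x ∷ xs) (x≥ ∷ desc) with x ℕ.≟ s
... | yes _ = desc
... | no  _ = All-delete xs x≥ ∷ delete-desc xs desc

-- Up to order, deleting one copy of `s` is inverse to adding one, and `P` guarantees a copy to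
-- delete.
count-remove-part : ∀ {P Q : Pred (List ℕ) 0ℓ} (P? : Decidable P) (Q? : Decidable Q) {s N} → 0 < s →
  (∀ {xs ys} → xs ↭ ys → P xs → P ys) → (∀ {xs ys} → xs ↭ ys → Q xs → Q ys) →
  (∀ {xs} → P xs → s ∈ xs) → (∀ {xs} → P (s ∷ xs) → Q xs) → (∀ {xs} → Q xs → P (s ∷ xs)) →
  count P? N ≡ count Q? (N ℤ.- + s)
count-remove-part {P} {Q} P? Q? {s} {N} 0<s P-resp Q-resp P⇒∈ P⇒Q Q⇒P =
  count-multiset-bijection P? Q? (delete s) (s ∷_) P-resp Q-resp
    (λ {xs} pos eq p → let s∈ = P⇒∈ p in All-delete xs pos , sum-delete s∈ eq , P⇒Q (P-resp (↭-sym (delete-↭ s∈)) p)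
      , λ ys↭ → ↭-trans (prep s ys↭) (delete-↭ s∈))
    (λ {xs} pos eq q → 0<s ∷ pos , sum-∷ {xs} eq , Q⇒P q , ∷-↭⇒delete-↭)
  where
  sum-∷ : ∀ {xs} → + sum xs ≡ N ℤ.- + s → + (s + sum xs) ≡ N
  sum-∷ {xs} eq = trans (cong (λ z → + s ℤ.+ z) eq) (cancel (+ s) N)
    where
    cancel : ∀ a b → a ℤ.+ (b ℤ.- a) ≡ b
    cancel = solve-∀
  sum-delete : ∀ {xs} → s ∈ xs → + sum xs ≡ N → + sum (delete s xs) ≡ N ℤ.- + s
  sum-delete {xs} s∈ refl = trans (cancel (+ s) (+ sum (delete s xs)))
    (cong (λ k → + k ℤ.- + s) (sum-↭ (delete-↭ s∈)))
    where
    cancel : ∀ a b → b ≡ (a ℤ.+ b) ℤ.- a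
    cancel = solve-∀

-- Odd parts

Odd : Pred ℕ 0ℓ
Odd x = T (isOdd x)

odd? : Decidable Odd
odd? x = T? (isOdd x)

-- Steps of four match the recursion of `quarter` and `swap₁₃`, so their properties need only the
-- base cases 1 and 3.
data Odd₄ : Pred ℕ 0ℓ where
  one   : Odd₄ 1
  three : Odd₄ 3
  four+ : ∀ {x} → Odd₄ x → Odd₄ (4 + x)

odd⇒odd₄ : ∀ x → Odd x → Odd₄ x
odd⇒odd₄ 1 _ = one
odd⇒odd₄ 3 _ = three
odd⇒odd₄ (suc (suc (suc (suc x)))) p = four+ (odd⇒odd₄ x p)

odd₄⇒odd : ∀ {x} → Odd₄ x → Odd x
odd₄⇒odd one = _
odd₄⇒odd three = _
odd₄⇒odd (four+ p) = odd₄⇒odd p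

-- ⌊(x + 1) / 4⌋
quarter : ℕ → ℕ
quarter (suc (suc (suc (suc x)))) = suc (quarter x)
quarter 3 = 1
quarter _ = 0

-- 4i + 1 ↔ 4i + 3
swap₁₃ : ℕ → ℕ
swap₁₃ (suc (suc (suc (suc x)))) = 4 + swap₁₃ x
swap₁₃ 3 = 1
swap₁₃ 1 = 3
swap₁₃ x = x

-- 4i - 1 ↔ 4i + 1 for i ≥ 1
swap₃₅ : ℕ → ℕ
swap₃₅ (suc (suc x)) = 2 + swap₁₃ x
swap₃₅ x = x

swap₁₃-odd : ∀ {x} → Odd₄ x → Odd₄ (swap₁₃ x)
swap₁₃-odd one = three
swap₁₃-odd three = one
swap₁₃-odd (four+ p) = four+ (swap₁₃-odd p)

swap₁₃-involutive : ∀ {x} → Odd₄ x → swap₁₃ (swap₁₃ x) ≡ x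
swap₁₃-involutive one = refl
swap₁₃-involutive three = refl
swap₁₃-involutive (four+ p) = cong (4 ℕ.+_) (swap₁₃-involutive p)

-- Together with `quarter-swap₁₃` this makes the exchange linear in x and `quarter x`. The
-- identities therefore add up over the parts of a partition.
swap₁₃-value : ∀ {x} → Odd₄ x → swap₁₃ x + 8 * quarter x ≡ 3 * x
swap₁₃-value one = refl
swap₁₃-value three = refl
swap₁₃-value (four+ {x} p) = trans (lemma (swap₁₃ x) (quarter x)) (trans (cong (12 ℕ.+_) (swap₁₃-value p)) (lemma′ x))
  where
  lemma : ∀ s t → 4 + s + 8 * (1 + t) ≡ 12 + (s + 8 * t)
  lemma = ℕ-Solver.solve-∀
  lemma′ : ∀ x → 12 + 3 * x ≡ 3 * (4 + x)
  lemma′ = ℕ-Solver.solve-∀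

quarter-swap₁₃ : ∀ {x} → Odd₄ x → quarter (swap₁₃ x) + 3 * quarter x ≡ x
quarter-swap₁₃ one = refl
quarter-swap₁₃ three = refl
quarter-swap₁₃ (four+ {x} p) = trans (lemma (quarter (swap₁₃ x)) (quarter x)) (cong (4 ℕ.+_) (quarter-swap₁₃ p))
  where
  lemma : ∀ s t → 1 + s + 3 * (1 + t) ≡ 4 + (s + 3 * t)
  lemma = ℕ-Solver.solve-∀

Odd≥3 : Pred ℕ 0ℓ
Odd≥3 x = Odd x × 3 ≤ x

odd≥3? : Decidable Odd≥3
odd≥3? x = odd? x ×-dec 3 ℕ.≤? x

-- After subtracting 2, the pair 4i - 1, 4i + 1 becomes a pair exchanged by `swap₁₃`.
data Odd₄+2 : Pred ℕ 0ℓ where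
  two+ : ∀ {x} → Odd₄ x → Odd₄+2 (2 + x)

odd≥3⇒odd₄+2 : ∀ {x} → Odd≥3 x → Odd₄+2 x
odd≥3⇒odd₄+2 {suc (suc x)} (p , _) = two+ (odd⇒odd₄ x p)
odd≥3⇒odd₄+2 {1} (_ , s≤s ())

odd₄⇒pos : ∀ {x} → Odd₄ x → 0 < x
odd₄⇒pos one = s≤s z≤n
odd₄⇒pos three = s≤s z≤n
odd₄⇒pos (four+ p) = s≤s z≤n

odd₄+2⇒odd≥3 : ∀ {x} → Odd₄+2 x → Odd≥3 x
odd₄+2⇒odd≥3 (two+ p) = odd₄⇒odd p , s≤s (s≤s (odd₄⇒pos p))

swap₃₅-odd : ∀ {x} → Odd₄+2 x → Odd₄+2 (swap₃₅ x)
swap₃₅-odd (two+ p) = two+ (swap₁₃-odd p)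

swap₃₅-involutive : ∀ {x} → Odd₄+2 x → swap₃₅ (swap₃₅ x) ≡ x
swap₃₅-involutive (two+ p) = cong (2 ℕ.+_) (swap₁₃-involutive p)

-- The pair 4i - 1, 4i + 1 adds up to 8i, and both members have quarter i.
swap₃₅-value : ∀ {x} → Odd₄+2 x → swap₃₅ x + x ≡ 8 * quarter x
swap₃₅-value (two+ one) = refl
swap₃₅-value (two+ three) = refl
swap₃₅-value (two+ (four+ {x} p)) = trans (lemma (swap₁₃ x) x) (trans (cong (8 ℕ.+_) (swap₃₅-value (two+ p))) (lemma′ (quarter (2 + x))))
  where
  lemma : ∀ s t → 2 + (4 + s) + (6 + t) ≡ 8 + (2 + s + (2 + t))
  lemma = ℕ-Solver.solve-∀
  lemma′ : ∀ x → 8 + 8 * x ≡ 8 * (1 + x)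
  lemma′ = ℕ-Solver.solve-∀

quarter-swap₃₅ : ∀ {x} → Odd₄+2 x → quarter (swap₃₅ x) ≡ quarter x
quarter-swap₃₅ (two+ one) = refl
quarter-swap₃₅ (two+ three) = refl
quarter-swap₃₅ (two+ (four+ p)) = cong suc (quarter-swap₃₅ (two+ p))

quarter≤id : ∀ x → quarter x ≤ x
quarter≤id 0 = z≤n
quarter≤id 1 = z≤n
quarter≤id 2 = z≤n
quarter≤id 3 = s≤s z≤n
quarter≤id (suc (suc (suc (suc x)))) = s≤s (ℕ.≤-trans (quarter≤id x) (ℕ.m≤n+m x 3))

quarters : List ℕ → ℕ
quarters xs = sum (map quarter xs)

quarters≤sum : ∀ xs → quarters xs ≤ sum xs
quarters≤sum []       = z≤n
quarters≤sum (x ∷ xs) = ℕ.+-mono-≤ (quarter≤id x) (quarters≤sum xs)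

quarters-↭ : ∀ {xs ys} → xs ↭ ys → quarters xs ≡ quarters ys
quarters-↭ p = sum-↭ (Perm.map⁺ quarter p)

-- Partitions refined by the sum of quarters

module _ {A : Pred ℕ 0ℓ} (A? : Decidable A) where

  Slice : ℤ → Pred (List ℕ) 0ℓ
  Slice n xs = All A xs × + quarters xs ≡ n

  slice? : ∀ n → Decidable (Slice n)
  slice? n xs = All.all? A? xs ×-dec (+ quarters xs ℤ.≟ n)

  slice : ℤ → ℤ → ℕ
  slice N n = count (slice? n) N

  slice-↭ : ∀ {n xs ys} → xs ↭ ys → Slice n xs → Slice n ys
  slice-↭ p (all , eq) = All-resp-↭ p all , trans (cong +_ (sym (quarters-↭ p))) eq

  map-involutive : ∀ {ρ : ℕ → ℕ} → (∀ {x} → A x → ρ (ρ x) ≡ x) → ∀ {xs} → All A xs → map ρ (map ρ xs) ≡ xs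
  map-involutive ρρ []         = refl
  map-involutive ρρ (px ∷ pxs) = cong₂ _∷_ (ρρ px) (map-involutive ρρ pxs)

  slice-involution : ∀ {N n N′ n′} (ρ : ℕ → ℕ) → (∀ {x} → A x → 0 < x) → (∀ {x} → A x → A (ρ x)) →
    (∀ {x} → A x → ρ (ρ x) ≡ x) →
    (∀ {xs} → All A xs → + sum xs ≡ N → + quarters xs ≡ n → (+ sum (map ρ xs) ≡ N′) × (+ quarters (map ρ xs) ≡ n′)) →
    (∀ {xs} → All A xs → + sum xs ≡ N′ → + quarters xs ≡ n′ → (+ sum (map ρ xs) ≡ N) × (+ quarters (map ρ xs) ≡ n)) →
    slice N n ≡ slice N′ n′
  slice-involution {N} {n} {N′} {n′} ρ A⇒pos ρ-A ρρ to from =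
    count-multiset-bijection (slice? n) (slice? n′) (map ρ) (map ρ) slice-↭ slice-↭ (half to) (half from)
    where
    half : ∀ {N n N′ n′} →
      (∀ {xs} → All A xs → + sum xs ≡ N → + quarters xs ≡ n → (+ sum (map ρ xs) ≡ N′) × (+ quarters (map ρ xs) ≡ n′)) →
      ∀ {xs} → All (0 <_) xs → + sum xs ≡ N → Slice n xs →
      All (0 <_) (map ρ xs) × + sum (map ρ xs) ≡ N′ × Slice n′ (map ρ xs) × (∀ {ys} → ys ↭ map ρ xs → map ρ ys ↭ xs)
    half to pos s (all , qs) = let (s′ , qs′) = to all s qs in
      All.map⁺ (All.map (A⇒pos ∘ ρ-A) all) , s′ , (All.map⁺ (All.map ρ-A all) , qs′)
      , λ ys↭ → ↭-trans (Perm.map⁺ ρ ys↭) (↭-reflexive (map-involutive ρρ all))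

oddSlice odd≥3Slice : ℤ → ℤ → ℕ
oddSlice = slice odd?
odd≥3Slice = slice odd≥3?

odd⇒pos : ∀ {x} → Odd x → 0 < x
odd⇒pos {suc x} _ = s≤s z≤n

oddSlice-negative : ∀ N k → oddSlice N -[1+ k ] ≡ 0
oddSlice-negative N k = count-zero (slice? odd? -[1+ k ]) {N} λ { _ (_ , ()) }

-- Distinguish whether 1 occurs. Since `quarter 1` is 0, removing one part 1 keeps n; without ones,
-- all odd parts are at least 3.
oddSlice-remove-1 : ∀ N n → oddSlice N n ≡ oddSlice (N ℤ.- + 1) n + odd≥3Slice N n
oddSlice-remove-1 N n = trans (count-split (slice? odd? n) (1 ∈?_) N) (cong₂ _+_ with-1 without-1)
  where
  with-1 = count-remove-part (λ xs → slice? odd? n xs ×-dec (1 ∈? xs)) (slice? odd? n) {N = N} (s≤s z≤n)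
    (λ { p (sl , 1∈) → slice-↭ odd? p sl , ∈-resp-↭ p 1∈ }) (slice-↭ odd?) proj₂
    (λ { ((_ ∷ odds , qs) , _) → odds , qs }) (λ { (odds , qs) → (_ ∷ odds , qs) , here refl })
  odd≢1 : ∀ x → Odd x → 1 ≢ x → 3 ≤ x
  odd≢1 1 _ 1≢1 = contradiction refl 1≢1
  odd≢1 (suc (suc (suc x))) _ _ = s≤s (s≤s (s≤s z≤n))
  no-1 : ∀ {xs} → All Odd xs → 1 ∉ xs → All Odd≥3 xs
  no-1 []                     1∉ = []
  no-1 {x ∷ _} (odd ∷ odds) 1∉ = (odd , odd≢1 x odd (1∉ ∘ here)) ∷ no-1 odds (1∉ ∘ there)
  1∉odd≥3 : ∀ {xs} → All Odd≥3 xs → 1 ∉ xs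
  1∉odd≥3 all 1∈ with proj₂ (All.lookup all 1∈)
  ... | s≤s ()
  without-1 = count-cong (λ xs → slice? odd? n xs ×-dec ¬? (1 ∈? xs)) (slice? odd≥3? n) {N}
    (λ { _ ((odds , qs) , 1∉) → no-1 odds 1∉ , qs })
    (λ { _ (all , qs) → (All.map proj₁ all , qs) , 1∉odd≥3 all })

sum-swap₃₅ : ∀ {xs} → All Odd≥3 xs → sum (map swap₃₅ xs) + sum xs ≡ 8 * quarters xs
sum-swap₃₅ [] = refl
sum-swap₃₅ {x ∷ xs} (px ∷ pxs) = trans (lemma (swap₃₅ x) (sum (map swap₃₅ xs)) x (sum xs))
  (trans (cong₂ _+_ (swap₃₅-value (odd≥3⇒odd₄+2 px)) (sum-swap₃₅ pxs)) (sym (ℕ.*-distribˡ-+ 8 (quarter x) (quarters xs))))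
  where
  lemma : ∀ a b c d → (a + b) + (c + d) ≡ (a + c) + (b + d)
  lemma = ℕ-Solver.solve-∀

quarters-swap₃₅ : ∀ {xs} → All Odd≥3 xs → quarters (map swap₃₅ xs) ≡ quarters xs
quarters-swap₃₅ [] = refl
quarters-swap₃₅ (px ∷ pxs) = cong₂ _+_ (quarter-swap₃₅ (odd≥3⇒odd₄+2 px)) (quarters-swap₃₅ pxs)

-- `swap₃₅`, applied to every part, keeps each quarter, and by `sum-swap₃₅` the old and the new size
-- add up to 8n.
odd≥3Slice-reflect : ∀ N n → odd≥3Slice N n ≡ odd≥3Slice (+ 8 ℤ.* n ℤ.- N) n
odd≥3Slice-reflect N n = slice-involution odd≥3? swap₃₅ (odd⇒pos ∘ proj₁) (λ p → odd₄+2⇒odd≥3 (swap₃₅-odd (odd≥3⇒odd₄+2 p)))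
  (λ p → swap₃₅-involutive (odd≥3⇒odd₄+2 p))
  (reflect N (+ 8 ℤ.* n ℤ.- N) (cancel N (+ 8 ℤ.* n))) (reflect (+ 8 ℤ.* n ℤ.- N) N (cancel′ N (+ 8 ℤ.* n)))
  where
  cancel : ∀ a b → b ≡ (b ℤ.- a) ℤ.+ a
  cancel = solve-∀
  cancel′ : ∀ a b → b ≡ a ℤ.+ (b ℤ.- a)
  cancel′ = solve-∀
  reflect : ∀ N N′ → + 8 ℤ.* n ≡ N′ ℤ.+ N → ∀ {xs} → All Odd≥3 xs → + sum xs ≡ N → + quarters xs ≡ n →
            (+ sum (map swap₃₅ xs) ≡ N′) × (+ quarters (map swap₃₅ xs) ≡ n)
  reflect N N′ eq {xs} all refl refl = +-cancelʳ (+ sum xs) _ _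
    (trans (cong +_ (sum-swap₃₅ all)) (trans (ℤ.pos-* 8 (quarters xs)) eq))
    , cong +_ (quarters-swap₃₅ all)

sum-swap₁₃ : ∀ {xs} → All Odd xs → sum (map swap₁₃ xs) + 8 * quarters xs ≡ 3 * sum xs
sum-swap₁₃ [] = refl
sum-swap₁₃ {x ∷ xs} (px ∷ pxs) = trans (lemma (swap₁₃ x) (sum (map swap₁₃ xs)) (quarter x) (quarters xs))
  (trans (cong₂ _+_ (swap₁₃-value (odd⇒odd₄ x px)) (sum-swap₁₃ pxs)) (sym (ℕ.*-distribˡ-+ 3 x (sum xs))))
  where
  lemma : ∀ a b c d → (a + b) + 8 * (c + d) ≡ (a + 8 * c) + (b + 8 * d)
  lemma = ℕ-Solver.solve-∀

quarters-swap₁₃ : ∀ {xs} → All Odd xs → quarters (map swap₁₃ xs) + 3 * quarters xs ≡ sum xs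
quarters-swap₁₃ [] = refl
quarters-swap₁₃ {x ∷ xs} (px ∷ pxs) = trans (lemma (quarter (swap₁₃ x)) (quarters (map swap₁₃ xs)) (quarter x) (quarters xs))
  (cong₂ _+_ (quarter-swap₁₃ (odd⇒odd₄ x px)) (quarters-swap₁₃ pxs))
  where
  lemma : ∀ a b c d → (a + b) + 3 * (c + d) ≡ (a + 3 * c) + (b + 3 * d)
  lemma = ℕ-Solver.solve-∀

oddSlice-reflect : ∀ N n → oddSlice N n ≡ oddSlice (+ 3 ℤ.* N ℤ.- + 8 ℤ.* n) (N ℤ.- + 3 ℤ.* n)
oddSlice-reflect N n = slice-involution odd? swap₁₃ odd⇒pos
  (λ {x} p → odd₄⇒odd (swap₁₃-odd (odd⇒odd₄ x p))) (λ {x} p → swap₁₃-involutive (odd⇒odd₄ x p))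
  (reflect N n N′ n′ (cancel (+ 3 ℤ.* N) (+ 8 ℤ.* n)) (cancel N (+ 3 ℤ.* n)))
  -- The linear map (N, n) ↦ (3N - 8n, N - 3n) is its own inverse, so `reflect` serves in both
  -- directions.
  (reflect N′ n′ N n (lemma N n) (lemma′ N n))
  where
  N′ = + 3 ℤ.* N ℤ.- + 8 ℤ.* n
  n′ = N ℤ.- + 3 ℤ.* n
  cancel : ∀ a b → a ≡ (a ℤ.- b) ℤ.+ b
  cancel = solve-∀
  lemma : ∀ N n → + 3 ℤ.* (+ 3 ℤ.* N ℤ.- + 8 ℤ.* n) ≡ N ℤ.+ + 8 ℤ.* (N ℤ.- + 3 ℤ.* n)
  lemma = solve-∀
  lemma′ : ∀ N n → (+ 3 ℤ.* N ℤ.- + 8 ℤ.* n) ≡ n ℤ.+ + 3 ℤ.* (N ℤ.- + 3 ℤ.* n)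
  lemma′ = solve-∀
  reflect : ∀ N n N′ n′ → + 3 ℤ.* N ≡ N′ ℤ.+ + 8 ℤ.* n → N ≡ n′ ℤ.+ + 3 ℤ.* n →
    ∀ {xs} → All Odd xs → + sum xs ≡ N → + quarters xs ≡ n →
    (+ sum (map swap₁₃ xs) ≡ N′) × (+ quarters (map swap₁₃ xs) ≡ n′)
  reflect N n N′ n′ eq eq′ {xs} all refl refl =
    +-cancelʳ (+ 8 ℤ.* + quarters xs) _ _
      (trans (cong (λ z → + sum (map swap₁₃ xs) ℤ.+ z) (sym (ℤ.pos-* 8 (quarters xs))))
        (trans (cong +_ (sum-swap₁₃ all)) (trans (ℤ.pos-* 3 (sum xs)) eq)))
    , +-cancelʳ (+ 3 ℤ.* + quarters xs) _ _
      (trans (cong (λ z → + quarters (map swap₁₃ xs) ℤ.+ z) (sym (ℤ.pos-* 3 (quarters xs)))) (trans (cong +_ (quarters-swap₁₃ all)) eq′))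

-- Alternating sums

-- The number r(e,n). As 4 `quarter x` is x - 1 for x = 4i + 1 and x + 1 for x = 4i + 3, prescribing
-- the size e + 4n and the sum n of quarters prescribes the excess e.
excessCount : ℤ → ℤ → ℤ
excessCount e n = + oddSlice (e ℤ.+ + 4 ℤ.* n) n

excessCount-negative : ∀ e {n} → n ℤ.< + 0 → excessCount e n ≡ + 0
excessCount-negative e { -[1+ k ]} _ = cong +_ (oddSlice-negative (e ℤ.+ + 4 ℤ.* -[1+ k ]) k)
excessCount-negative e {+ n} (ℤ.+<+ ())

-- Exchanging 4i + 1 and 4i + 3 negates the excess and changes the sum of quarters by the old
-- excess.
excessCount-reflect : ∀ e n → excessCount (ℤ.- e) n ≡ excessCount e (n ℤ.- e)
excessCount-reflect e n = cong +_ (trans (oddSlice-reflect (ℤ.- e ℤ.+ + 4 ℤ.* n) n) (cong₂ oddSlice (lemma e n) (lemma′ e n)))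
  where
  lemma : ∀ e n → + 3 ℤ.* (ℤ.- e ℤ.+ + 4 ℤ.* n) ℤ.- + 8 ℤ.* n ≡ e ℤ.+ + 4 ℤ.* (n ℤ.- e)
  lemma = solve-∀
  lemma′ : ∀ e n → (ℤ.- e ℤ.+ + 4 ℤ.* n) ℤ.- + 3 ℤ.* n ≡ n ℤ.- e
  lemma′ = solve-∀

excessPair : ℤ → ℤ → ℤ
excessPair n e = excessCount e n ℤ.+ excessCount (ℤ.pred (ℤ.- e)) n

-- A part 1 in the first term is removed, which lowers the excess to e - 1. The partitions without
-- ones are reflected to size 4n - e; the second term, with a part 1 added, supplies those of size
-- 4n - e that contain ones. Together these last two give excess -e.
excessPair-pred : ∀ n e → excessPair n e ≡ excessPair n (ℤ.pred e)
excessPair-pred n e = begin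
  excessCount e n ℤ.+ excessCount (ℤ.pred (ℤ.- e)) n
    ≡⟨ cong₂ (λ x y → x ℤ.+ + oddSlice y n) (cong +_ (oddSlice-remove-1 N n)) (lemma₁ e n) ⟩
  + oddSlice (N ℤ.- + 1) n ℤ.+ + odd≥3Slice N n ℤ.+ + oddSlice (N′ ℤ.- + 1) n
    ≡⟨ ℤ.+-assoc (+ oddSlice (N ℤ.- + 1) n) (+ odd≥3Slice N n) (+ oddSlice (N′ ℤ.- + 1) n) ⟩
  + oddSlice (N ℤ.- + 1) n ℤ.+ (+ odd≥3Slice N n ℤ.+ + oddSlice (N′ ℤ.- + 1) n)
    ≡⟨ cong (λ x → + oddSlice (N ℤ.- + 1) n ℤ.+ x) (ℤ.+-comm (+ odd≥3Slice N n) (+ oddSlice (N′ ℤ.- + 1) n)) ⟩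
  + oddSlice (N ℤ.- + 1) n ℤ.+ + (oddSlice (N′ ℤ.- + 1) n + odd≥3Slice N n)
    ≡⟨ cong (λ x → + oddSlice (N ℤ.- + 1) n ℤ.+ + (oddSlice (N′ ℤ.- + 1) n + x)) (odd≥3Slice-reflect N n) ⟩
  + oddSlice (N ℤ.- + 1) n ℤ.+ + (oddSlice (N′ ℤ.- + 1) n + odd≥3Slice N′ n)
    ≡⟨ cong (λ x → + oddSlice (N ℤ.- + 1) n ℤ.+ + x) (sym (oddSlice-remove-1 N′ n)) ⟩
  + oddSlice (N ℤ.- + 1) n ℤ.+ + oddSlice N′ n
    ≡⟨ cong₂ (λ x y → + oddSlice x n ℤ.+ + oddSlice y n) (lemma₂ e n) (lemma₃ e n) ⟩
  excessPair n (ℤ.pred e) ∎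
  where
  open ≡-Reasoning
  N  = e ℤ.+ + 4 ℤ.* n
  N′ = + 8 ℤ.* n ℤ.- N
  lemma₁ : ∀ e n → ℤ.pred (ℤ.- e) ℤ.+ + 4 ℤ.* n ≡ + 8 ℤ.* n ℤ.- (e ℤ.+ + 4 ℤ.* n) ℤ.- + 1
  lemma₁ = identity
    where
    identity : ∀ e n → (ℤ.- + 1 ℤ.+ (ℤ.- e)) ℤ.+ + 4 ℤ.* n ≡ + 8 ℤ.* n ℤ.- (e ℤ.+ + 4 ℤ.* n) ℤ.- + 1
    identity = solve-∀
  lemma₂ : ∀ e n → (e ℤ.+ + 4 ℤ.* n) ℤ.- + 1 ≡ (ℤ.- + 1 ℤ.+ e) ℤ.+ + 4 ℤ.* n
  lemma₂ = solve-∀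
  lemma₃ : ∀ e n → + 8 ℤ.* n ℤ.- (e ℤ.+ + 4 ℤ.* n) ≡ (ℤ.- + 1 ℤ.+ ℤ.- (ℤ.- + 1 ℤ.+ e)) ℤ.+ + 4 ℤ.* n
  lemma₃ = solve-∀

excessPair-constant : ∀ n e → excessPair n e ≡ excessPair n (+ 0)
excessPair-constant n (+ zero)     = refl
excessPair-constant n (+ suc k)    = trans (excessPair-pred n (+ suc k)) (excessPair-constant n (+ k))
excessPair-constant n -[1+ zero ]  = sym (excessPair-pred n (+ 0))
excessPair-constant n -[1+ suc k ] = trans (sym (excessPair-pred n -[1+ k ])) (excessPair-constant n -[1+ k ])

-- The sum of (-1)^j f(j) over -J-1 ≤ j ≤ J.
altsum : ℕ → (ℤ → ℤ) → ℤ
altsum J f = sumℤ J (λ i → sgn i ℤ.* (f (+ i) ℤ.- f -[1+ i ]))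

sumℤ-cong : ∀ J {f g : ℕ → ℤ} → (∀ i → i ≤ J → f i ≡ g i) → sumℤ J f ≡ sumℤ J g
sumℤ-cong zero    eq = eq 0 z≤n
sumℤ-cong (suc J) eq = cong₂ ℤ._+_ (sumℤ-cong J (λ i i≤J → eq i (ℕ.m≤n⇒m≤1+n i≤J))) (eq (suc J) ℕ.≤-refl)

sumℤ-zero : ∀ J {f : ℕ → ℤ} → (∀ i → i ≤ J → f i ≡ + 0) → sumℤ J f ≡ + 0
sumℤ-zero zero    eq = eq 0 z≤n
sumℤ-zero (suc J) eq = cong₂ ℤ._+_ (sumℤ-zero J (λ i i≤J → eq i (ℕ.m≤n⇒m≤1+n i≤J))) (eq (suc J) ℕ.≤-refl)

sumℤ-+ : ∀ J (f g : ℕ → ℤ) → sumℤ J (λ i → f i ℤ.+ g i) ≡ sumℤ J f ℤ.+ sumℤ J g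
sumℤ-+ zero    f g = refl
sumℤ-+ (suc J) f g = trans (cong (λ x → x ℤ.+ (f (suc J) ℤ.+ g (suc J))) (sumℤ-+ J f g))
  (lemma (sumℤ J f) (sumℤ J g) (f (suc J)) (g (suc J)))
  where
  lemma : ∀ a b c d → (a ℤ.+ b) ℤ.+ (c ℤ.+ d) ≡ (a ℤ.+ c) ℤ.+ (b ℤ.+ d)
  lemma = solve-∀

altsum-cong : ∀ J {f g : ℤ → ℤ} → (∀ j → f j ≡ g j) → altsum J f ≡ altsum J g
altsum-cong J eq = sumℤ-cong J (λ i _ → cong₂ (λ x y → sgn i ℤ.* (x ℤ.- y)) (eq (+ i)) (eq -[1+ i ]))

altsum-+ : ∀ J (f g : ℤ → ℤ) → altsum J (λ j → f j ℤ.+ g j) ≡ altsum J f ℤ.+ altsum J g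
altsum-+ J f g = trans (sumℤ-cong J (λ i _ → lemma (sgn i) (f (+ i)) (g (+ i)) (f -[1+ i ]) (g -[1+ i ]))) (sumℤ-+ J _ _)
  where
  lemma : ∀ s a b c d → s ℤ.* ((a ℤ.+ b) ℤ.- (c ℤ.+ d)) ≡ s ℤ.* (a ℤ.- c) ℤ.+ s ℤ.* (b ℤ.- d)
  lemma = solve-∀

-- The indices i and -1 - i have opposite parity, so their terms cancel.
altsum-symmetric : ∀ J {f : ℤ → ℤ} → (∀ i → f (+ i) ≡ f -[1+ i ]) → altsum J f ≡ + 0
altsum-symmetric J {f} eq = sumℤ-zero J λ i _ →
  trans (cong (λ x → sgn i ℤ.* x) (trans (cong (λ x → x ℤ.- f -[1+ i ]) (eq i)) (ℤ.+-inverseʳ (f -[1+ i ])))) (ℤ.*-zeroʳ (sgn i))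

altsum-sumℤ : ∀ J B (f : ℕ → ℤ → ℤ) → altsum J (λ j → sumℤ B (λ m → f m j)) ≡ sumℤ B (λ m → altsum J (f m))
altsum-sumℤ J zero    f = refl
altsum-sumℤ J (suc B) f = trans (altsum-+ J (λ j → sumℤ B (λ m → f m j)) (f (suc B))) (cong (λ x → x ℤ.+ altsum J (f (suc B))) (altsum-sumℤ J B f))

-- Shifting the index flips the sign (-1)^j, so everything cancels except one term at each end of
-- the range.
altsum-suc : ∀ J (f : ℤ → ℤ) →
  altsum J (f ∘ ℤ.suc) ℤ.+ altsum J f ≡ sgn J ℤ.* (f (+ suc J) ℤ.- f -[1+ J ])
altsum-suc zero f = lemma (f (+ 0)) (f (+ 1)) (f -[1+ 0 ])
  where
  lemma : ∀ a b c → + 1 ℤ.* (b ℤ.- a) ℤ.+ + 1 ℤ.* (a ℤ.- c) ≡ + 1 ℤ.* (b ℤ.- c)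
  lemma = solve-∀
altsum-suc (suc J) f = trans (lemma (altsum J (f ∘ ℤ.suc)) (altsum J f) (sgn J) a b c d)
  (trans (cong (λ x → x ℤ.+ ℤ.- sgn J ℤ.* ((a ℤ.- b) ℤ.+ (c ℤ.- d))) (altsum-suc J f)) (lemma′ (sgn J) a b c d))
  where
  a = f (+ suc (suc J))
  b = f -[1+ J ]
  c = f (+ suc J)
  d = f -[1+ suc J ]
  lemma : ∀ x y s a b c d → (x ℤ.+ ℤ.- s ℤ.* (a ℤ.- b)) ℤ.+ (y ℤ.+ ℤ.- s ℤ.* (c ℤ.- d))
        ≡ (x ℤ.+ y) ℤ.+ ℤ.- s ℤ.* ((a ℤ.- b) ℤ.+ (c ℤ.- d))
  lemma = solve-∀
  lemma′ : ∀ s a b c d → s ℤ.* (c ℤ.- b) ℤ.+ ℤ.- s ℤ.* ((a ℤ.- b) ℤ.+ (c ℤ.- d)) ≡ ℤ.- s ℤ.* (a ℤ.- d)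
  lemma′ = solve-∀

-- Multiplication by the theta series

triangle : ℕ → ℕ
triangle zero    = 0
triangle (suc i) = triangle i + suc i

-- j (j + 1) / 2
tri : ℤ → ℕ
tri (+ i)    = triangle i
tri -[1+ i ] = triangle i

tri-pred : ∀ j → + tri (ℤ.pred j) ℤ.+ j ≡ + tri j
tri-pred (+ zero)  = refl
tri-pred (+ suc i) = refl
tri-pred -[1+ i ]  = lemma (+ triangle i) (+ suc i)
  where
  lemma : ∀ a b → (a ℤ.+ b) ℤ.+ ℤ.- b ≡ a
  lemma = solve-∀

-- The coefficient of zᵈ Qⁿ in the product of the theta series with
-- Σ excessCount(e,n) zᵉ Qⁿ = 1 / ((z;Q)∞ (Q/z;Q)∞), truncated to -J-1 ≤ j ≤ J.
thetaCoefficient : ℕ → ℤ → ℤ → ℤ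
thetaCoefficient J d n = altsum J (λ j → excessCount (d ℤ.+ j) (n ℤ.- + tri j))

n-+m<0 : ∀ {n} m → n ℤ.< + m → n ℤ.- + m ℤ.< + 0
n-+m<0 {n} m n<m = subst (λ z → n ℤ.- + m ℤ.< z) (ℤ.+-inverseʳ (+ m)) (ℤ.+-monoˡ-< (ℤ.- + m) n<m)

-- Pairing each term f(j) with h(j + 1) gives a value of `excessPair`, which depends on j only
-- through `tri j`; the paired sum vanishes by symmetry. Undoing the index shift in h flips the
-- sign, and reflecting each excess turns h into the sum for n - d.
thetaCoefficient-shift : ∀ J d n → n ℤ.< + triangle J → thetaCoefficient J d n ≡ thetaCoefficient J d (n ℤ.- d)
thetaCoefficient-shift J d n n<TJ = begin
  altsum J f                                                ≡⟨ lemma (altsum J f) (altsum J (h ∘ ℤ.suc)) (altsum J h) ⟩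
  (altsum J f ℤ.+ altsum J (h ∘ ℤ.suc)) ℤ.- (altsum J (h ∘ ℤ.suc) ℤ.+ altsum J h) ℤ.+ altsum J h
    ≡⟨ cong₂ (λ x y → x ℤ.- y ℤ.+ altsum J h) f+h (trans (altsum-suc J h) boundary) ⟩
  + 0 ℤ.- + 0 ℤ.+ altsum J h                                ≡⟨ ℤ.+-identityˡ _ ⟩
  altsum J h                                                ≡⟨ altsum-cong J h-reflect ⟩
  thetaCoefficient J d (n ℤ.- d)                                           ∎
  where
  open ≡-Reasoning
  f h : ℤ → ℤ
  f j = excessCount (d ℤ.+ j) (n ℤ.- + tri j)
  h j = excessCount (ℤ.- (d ℤ.+ j)) (n ℤ.- + tri (ℤ.pred j))
  lemma : ∀ a b c → a ≡ (a ℤ.+ b) ℤ.- (b ℤ.+ c) ℤ.+ c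
  lemma = solve-∀
  arg : ∀ d j → ℤ.- (d ℤ.+ (+ 1 ℤ.+ j)) ≡ ℤ.- + 1 ℤ.+ ℤ.- (d ℤ.+ j)
  arg = solve-∀
  f+h : altsum J f ℤ.+ altsum J (h ∘ ℤ.suc) ≡ + 0
  f+h = trans (sym (altsum-+ J f (h ∘ ℤ.suc))) (trans (altsum-cong J λ j →
      trans (cong₂ (λ x y → f j ℤ.+ excessCount x (n ℤ.- + tri y)) (arg d j) (ℤ.pred-suc j)) (excessPair-constant (n ℤ.- + tri j) (d ℤ.+ j)))
    (altsum-symmetric J {λ j → excessPair (n ℤ.- + tri j) (+ 0)} λ _ → refl))
  -- At j = J + 1 and j = -J - 1 the second argument n - `tri (pred j)` is negative because n <
  -- `triangle J`.
  boundary : sgn J ℤ.* (h (+ suc J) ℤ.- h -[1+ J ]) ≡ + 0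
  boundary = trans (cong₂ (λ x y → sgn J ℤ.* (x ℤ.- y)) (excessCount-negative (ℤ.- (d ℤ.+ + suc J)) (n-+m<0 _ n<TJ))
    (excessCount-negative (ℤ.- (d ℤ.+ -[1+ J ])) (n-+m<0 _ (ℤ.<-≤-trans n<TJ (ℤ.+≤+ (ℕ.m≤m+n (triangle J) (suc J))))))) (ℤ.*-zeroʳ (sgn J))
  h-reflect : ∀ j → h j ≡ excessCount (d ℤ.+ j) (n ℤ.- d ℤ.- + tri j)
  h-reflect j = trans (excessCount-reflect (d ℤ.+ j) _) (cong (excessCount (d ℤ.+ j))
    (trans (lemma′ n (+ tri (ℤ.pred j)) d j) (cong (λ x → n ℤ.- d ℤ.- x) (tri-pred j))))
    where
    lemma′ : ∀ n t d j → n ℤ.- t ℤ.- (d ℤ.+ j) ≡ n ℤ.- d ℤ.- (t ℤ.+ j)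
    lemma′ = solve-∀

thetaCoefficient-negative : ∀ J d {n} → n ℤ.< + 0 → thetaCoefficient J d n ≡ + 0
thetaCoefficient-negative J d {n} n<0 = sumℤ-zero J λ i _ →
  trans (cong₂ (λ x y → sgn i ℤ.* (x ℤ.- y)) (excessCount-negative (d ℤ.+ + i) (neg i)) (excessCount-negative (d ℤ.+ -[1+ i ]) (neg i))) (ℤ.*-zeroʳ (sgn i))
  where
  neg : ∀ i → n ℤ.- + triangle i ℤ.< + 0
  neg i = n-+m<0 _ (ℤ.<-≤-trans n<0 (ℤ.+≤+ z≤n))

-- For d ≠ 0 the shift lowers n by |d| without changing the value, until n is negative and every
-- term is zero. The counter k bounds n from above.
thetaCoefficient-vanishes : ∀ J d n → d ≢ + 0 → n ℤ.< + triangle J → thetaCoefficient J d n ≡ + 0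
thetaCoefficient-vanishes J d n d≢0 n<TJ = go (triangle J) d n d≢0 n<TJ n<TJ
  where
  decrease : ∀ {n k} p → n ℤ.< + suc k → n ℤ.- + suc p ℤ.< + k
  decrease {n} {k} p n<k = ℤ.<-≤-trans (ℤ.+-monoˡ-< (ℤ.- + suc p) n<k)
    (subst (ℤ._≤ + k) (lemma (+ k) (+ p)) (ℤ.i-j≤i (+ k) (+ p)))
    where
    lemma : ∀ k p → k ℤ.- p ≡ (+ 1 ℤ.+ k) ℤ.- (+ 1 ℤ.+ p)
    lemma = solve-∀
  cancel : ∀ n d → n ≡ n ℤ.- d ℤ.+ d
  cancel = solve-∀
  go : ∀ k d n → d ≢ + 0 → n ℤ.< + k → n ℤ.< + triangle J → thetaCoefficient J d n ≡ + 0
  go zero    d n _ n<0 _ = thetaCoefficient-negative J d n<0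
  go (suc k) (+ zero) n d≢0 _ _ = contradiction refl d≢0
  go (suc k) d@(+ suc p) n d≢0 n<k n<TJ =
    trans (thetaCoefficient-shift J d n n<TJ) (go k d (n ℤ.- d) d≢0 (decrease p n<k) (ℤ.≤-<-trans (ℤ.i-j≤i n (+ suc p)) n<TJ))
  -- For negative d the shift is read backwards, starting from n - |d|.
  go (suc k) d@(-[1+ p ]) n d≢0 n<k n<TJ =
    trans (cong (thetaCoefficient J d) (cancel n (+ suc p))) (trans (sym (thetaCoefficient-shift J d (n ℤ.- + suc p) bound)) (go k d (n ℤ.- + suc p) d≢0 (decrease p n<k) bound))
    where
    bound = ℤ.≤-<-trans (ℤ.i-j≤i n (+ suc p)) n<TJ

-- The alternating sum over hexagonal numbers

allOdd? : Decidable (All Odd)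
allOdd? = All.all? odd?

oddCount : ℤ → ℕ
oddCount = count allOdd?

-- The index m stands for s plus the sum of quarters. With s = `tri j` the range of m becomes the
-- same for all j, so that the sums over j and m can be exchanged.
oddCount-slices : ∀ N s B → (∀ {xs} → IsPartition N xs → s + quarters xs ≤ B) →
  + oddCount N ≡ sumℤ B (λ m → + oddSlice N (+ m ℤ.- + s))
oddCount-slices N s B bound = trans
  (cong +_ (count-cong allOdd? (bounded? B) {N} (λ part odds → odds , bound part) (λ _ → proj₁))) (go B)
  where
  bounded? : ∀ B → Decidable (λ xs → All Odd xs × s + quarters xs ≤ B)
  bounded? B xs = allOdd? xs ×-dec (s + quarters xs ℕ.≤? B)
  to : ∀ m k → s + k ≡ m → + k ≡ + m ℤ.- + s
  to m k refl = lemma (+ s) (+ k)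
    where
    lemma : ∀ s k → k ≡ (s ℤ.+ k) ℤ.- s
    lemma = solve-∀
  from : ∀ m k → + k ≡ + m ℤ.- + s → s + k ≡ m
  from m k eq = ℤ.+-injective (trans (cong (λ z → + s ℤ.+ z) eq) (lemma (+ s) (+ m)))
    where
    lemma : ∀ s m → s ℤ.+ (m ℤ.- s) ≡ m
    lemma = solve-∀
  go : ∀ B → + count (bounded? B) N ≡ sumℤ B (λ m → + oddSlice N (+ m ℤ.- + s))
  go zero = cong +_ (count-cong (bounded? 0) (slice? odd? (+ 0 ℤ.- + s)) {N}
    (λ { {xs} _ (odds , le) → odds , to 0 (quarters xs) (ℕ.n≤0⇒n≡0 le) })
    (λ { {xs} _ (odds , eq) → odds , ℕ.≤-reflexive (from 0 (quarters xs) eq) }))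
  go (suc B) = trans (cong +_ (trans (count-split (bounded? (suc B)) (λ xs → s + quarters xs ℕ.≤? B) N)
    (cong₂ _+_
      (count-cong (λ xs → bounded? (suc B) xs ×-dec (s + quarters xs ℕ.≤? B)) (bounded? B) {N}
        (λ { _ ((odds , _) , le) → odds , le })
        (λ { _ (odds , le) → (odds , ℕ.m≤n⇒m≤1+n le) , le }))
      (count-cong (λ xs → bounded? (suc B) xs ×-dec ¬? (s + quarters xs ℕ.≤? B)) (slice? odd? (+ suc B ℤ.- + s)) {N}
        (λ { {xs} _ ((odds , le) , nle) → odds , to (suc B) (quarters xs) (ℕ.≤-antisym le (ℕ.≰⇒> nle)) })
        (λ { {xs} _ (odds , eq) → let e = from (suc B) (quarters xs) eq in
             (odds , ℕ.≤-reflexive e) , λ le → ℕ.<-irrefl refl (subst (_≤ B) e le) })))))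
    (cong (λ x → x ℤ.+ + oddSlice N (+ suc B ℤ.- + s)) (go B))

-- j (2j + 1)
hexagonal : ℤ → ℤ
hexagonal j = + 4 ℤ.* + tri j ℤ.- j

n≤triangle : ∀ n → n ≤ triangle n
n≤triangle zero    = z≤n
n≤triangle (suc n) = ℕ.m≤n+m (suc n) (triangle n)

j≤3tri : ∀ j → j ℤ.≤ + 3 ℤ.* + tri j
j≤3tri (+ i) = subst (+ i ℤ.≤_) (ℤ.pos-* 3 (triangle i))
  (ℤ.+≤+ (ℕ.≤-trans (n≤triangle i) (ℕ.m≤n*m (triangle i) 3)))
j≤3tri -[1+ i ] = subst (-[1+ i ] ℤ.≤_) (ℤ.pos-* 3 (triangle i)) ℤ.-≤+

¬odd-4* : ∀ m → ¬ Odd (4 * m)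
¬odd-4* zero    ()
¬odd-4* (suc m) odd = ¬odd-4* m (subst Odd (ℕ.*-suc 4 m) odd)

-- For odd N the sum is the coefficient of q^N in (q⁴;q⁴)∞, by Jacobi's triple product.
oddCount-altsum : ∀ {N} J → Odd N → N < triangle J → altsum J (λ j → + oddCount (+ N ℤ.- hexagonal j)) ≡ + 0
oddCount-altsum {N} J odd N<TJ = begin
  altsum J (λ j → + oddCount (+ N ℤ.- hexagonal j))
    ≡⟨ altsum-cong J (λ j → oddCount-slices (+ N ℤ.- hexagonal j) (tri j) N (bound j)) ⟩
  altsum J (λ j → sumℤ N (λ m → + oddSlice (+ N ℤ.- hexagonal j) (+ m ℤ.- + tri j)))
    ≡⟨ altsum-sumℤ J N (λ m j → + oddSlice (+ N ℤ.- hexagonal j) (+ m ℤ.- + tri j)) ⟩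
  sumℤ N (λ m → altsum J (λ j → + oddSlice (+ N ℤ.- hexagonal j) (+ m ℤ.- + tri j)))
    ≡⟨ sumℤ-cong N (λ m _ → altsum-cong J (λ j → cong (λ x → + oddSlice x (+ m ℤ.- + tri j)) (weight (+ N) (+ m) (+ tri j) j))) ⟩
  sumℤ N (λ m → thetaCoefficient J (+ N ℤ.- + 4 ℤ.* + m) (+ m))
    ≡⟨ sumℤ-zero N (λ m m≤N → thetaCoefficient-vanishes J (+ N ℤ.- + 4 ℤ.* + m) (+ m) (nonzero m) (ℤ.+<+ (ℕ.≤-<-trans m≤N N<TJ))) ⟩
  + 0 ∎
  where
  open ≡-Reasoning
  -- In the slice with index m the excess is d + j with d = N - 4m independent of j, as
  -- `thetaCoefficient` requires.
  weight : ∀ N m t j → N ℤ.- (+ 4 ℤ.* t ℤ.- j) ≡ (N ℤ.- + 4 ℤ.* m ℤ.+ j) ℤ.+ + 4 ℤ.* (m ℤ.- t)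
  weight = solve-∀
  nonzero : ∀ m → + N ℤ.- + 4 ℤ.* + m ≢ + 0
  nonzero m eq = ¬odd-4* m (subst Odd (ℤ.+-injective (trans (ℤ.i-j≡0⇒i≡j (+ N) (+ 4 ℤ.* + m) eq) (sym (ℤ.pos-* 4 m)))) odd)
  -- `tri j` plus the size N - `hexagonal j` equals N + (j - 3 `tri j`), and j ≤ 3 `tri j`.
  bound : ∀ j {xs} → IsPartition (+ N ℤ.- hexagonal j) xs → tri j + quarters xs ≤ N
  bound j {xs} (_ , _ , eq) = ℕ.≤-trans (ℕ.+-monoʳ-≤ (tri j) (quarters≤sum xs)) (ℤ.drop‿+≤+
    (subst (ℤ._≤ + N) (sym (trans (cong (λ z → + tri j ℤ.+ z) eq) (lemma (+ N) (+ tri j) j)))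
      (ℤ.≤-trans (ℤ.+-monoʳ-≤ (+ N) (ℤ.i≤j⇒i-j≤0 (j≤3tri j))) (ℤ.≤-reflexive (ℤ.+-identityʳ (+ N))))))
    where
    lemma : ∀ N t j → t ℤ.+ (N ℤ.- (+ 4 ℤ.* t ℤ.- j)) ≡ N ℤ.+ (j ℤ.- + 3 ℤ.* t)
    lemma = solve-∀

-- The rectangle condition

-- xᵢ ≠ c + (i - 1) s for every i ≥ 1
Avoid : ℕ → ℕ → Pred (List ℕ) 0ℓ
Avoid s c []       = ⊤
Avoid s c (x ∷ xs) = x ≢ c × Avoid s (s + c) xs

avoid? : ∀ s c → Decidable (Avoid s c)
avoid? s c []       = yes tt
avoid? s c (x ∷ xs) = ¬? (x ℕ.≟ c) ×-dec avoid? s (s + c) xs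

all<⇒avoid : ∀ s {c xs} → All (_< c) xs → Avoid s c xs
all<⇒avoid s [] = tt
all<⇒avoid s {c} (x<c ∷ xs<c) = ℕ.<⇒≢ x<c , all<⇒avoid s (All.map (λ lt → ℕ.<-≤-trans lt (ℕ.m≤n+m c s)) xs<c)

indexFrom : ℕ → List ℕ → List (ℕ × ℕ)
indexFrom i []       = []
indexFrom i (x ∷ xs) = (i , x) ∷ indexFrom (suc i) xs

zip-applyUpTo : ∀ (f : ℕ → ℕ) i → (∀ k → f k ≡ k + i) → ∀ xs → zip (applyUpTo f (length xs)) xs ≡ indexFrom i xs
zip-applyUpTo f i eq []       = refl
zip-applyUpTo f i eq (x ∷ xs) = cong₂ _∷_ (cong (_, x) (eq 0))
  (zip-applyUpTo (f ∘ suc) (suc i) (λ k → trans (eq (suc k)) (sym (ℕ.+-suc k i))) xs)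

indexed≡indexFrom : ∀ xs → indexed xs ≡ indexFrom 1 xs
indexed≡indexFrom xs = trans (cong (λ is → zip is xs) (map-upTo suc (length xs))) (zip-applyUpTo suc 1 (λ k → ℕ.+-comm 1 k) xs)

height : ℕ → List (ℕ × ℕ) → ℕ
height ν []               = 0
height ν ((i , l) ∷ rest) = (if (i + ν + 2) ≤ᵇ l then i else 0) ⊔ height ν rest

-- The recursion determines the function. This identifies the recursion inside `durfeeT` with
-- `height`.
height-unique : ∀ ν (g : List (ℕ × ℕ) → ℕ) → g [] ≡ 0 →
  (∀ i l rest → g ((i , l) ∷ rest) ≡ (if (i + ν + 2) ≤ᵇ l then i else 0) ⊔ g rest) → ∀ xs → g xs ≡ height ν xs
height-unique ν g g[] g∷ []             = g[]
height-unique ν g g[] g∷ ((i , l) ∷ xs) = trans (g∷ i l xs) (cong (_ ⊔_) (height-unique ν g g[] g∷ xs))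

-- Unification solves height′ with the function that is local to durfeeT and cannot be named.
mutual
  height′ : ℕ → List ℕ → List (ℕ × ℕ) → ℕ
  height′ = _

  durfeeT≡height : ∀ ν ls → durfeeT ν ls ≡ height ν (indexed ls)
  -- Once `indexed ls` is abstracted to a variable, the equation for `height′ ν ls xs` has distinct
  -- variables as arguments and can be solved.
  durfeeT≡height ν ls with indexed ls
  ... | xs = height-unique ν (height′ ν ls) refl (λ _ _ _ → refl) xs

Below : ℕ → ℕ → Pred (ℕ × ℕ) 0ℓ
Below ν t (i , l) = i ≤ t ⊎ l < t + ν + 2

height-low : ∀ ν i {x} xs → All (_≤ x) xs → x < i + ν + 2 → height ν (indexFrom i xs) ≡ 0
height-low ν i []       []           _  = refl
height-low ν i (y ∷ ys) (y≤x ∷ ys≤x) x< with (i + ν + 2) ≤ᵇ y in eq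
... | true  = contradiction (ℕ.≤ᵇ⇒≤ _ _ (subst T (sym eq) _)) (ℕ.<⇒≱ (ℕ.≤-<-trans y≤x x<))
... | false = height-low ν (suc i) ys ys≤x (ℕ.m<n⇒m<1+n x<)

all-indexFrom : ∀ {P : Pred ℕ 0ℓ} i {xs} → All P xs → All (P ∘ proj₂) (indexFrom i xs)
all-indexFrom i []         = []
all-indexFrom i (px ∷ pxs) = px ∷ all-indexFrom (suc i) pxs

-- The induction runs over the rows below the first s rows, which all reach beyond the rectangle.
below⇔avoid : ∀ ν s ls → Desc ls → let t = s ⊔ height ν (indexFrom (suc s) ls) in
  (All (Below ν t) (indexFrom (suc s) ls) → Avoid 1 (s + ν + 2) ls) ×
  (Avoid 1 (s + ν + 2) ls → All (Below ν t) (indexFrom (suc s) ls))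
below⇔avoid ν s [] [] = (λ _ → tt) , (λ _ → [])
below⇔avoid ν s (x ∷ xs) (x≥ ∷ desc) with (suc s + ν + 2) ≤ᵇ x in eq
-- The row reaches past the forbidden size and belongs to the rectangle, so both conditions pass to
-- the rows below it.
... | true = to , from
  where
  c<x : s + ν + 2 < x
  c<x = ℕ.≤ᵇ⇒≤ (suc s + ν + 2) x (subst T (sym eq) _)
  IH = below⇔avoid ν (suc s) xs desc
  h = height ν (indexFrom (suc (suc s)) xs)
  t≡ : s ⊔ (suc s ⊔ h) ≡ suc s ⊔ h
  t≡ = ℕ.m≤n⇒m⊔n≡n (ℕ.≤-trans (ℕ.n≤1+n s) (ℕ.m≤m⊔n (suc s) h))
  to : All (Below ν (s ⊔ (suc s ⊔ h))) ((suc s , x) ∷ indexFrom (suc (suc s)) xs) → Avoid 1 (s + ν + 2) (x ∷ xs)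
  to below = ℕ.>⇒≢ c<x , proj₁ IH (All.tail (subst (λ t → All (Below ν t) ((suc s , x) ∷ indexFrom (suc (suc s)) xs)) t≡ below))
  from : Avoid 1 (s + ν + 2) (x ∷ xs) → All (Below ν (s ⊔ (suc s ⊔ h))) ((suc s , x) ∷ indexFrom (suc (suc s)) xs)
  from (_ , avoid) = subst (λ t → All (Below ν t) ((suc s , x) ∷ indexFrom (suc (suc s)) xs)) (sym t≡)
    (inj₁ (ℕ.m≤m⊔n (suc s) h) ∷ proj₂ IH avoid)
-- No row from here on can enlarge the rectangle, so t = s. As x ≤ s + ν + 2, the condition x < s +
-- ν + 2 says exactly that x avoids this value, and then all later rows lie below their forbidden
-- sizes.
... | false = to , from
  where
  x<1+c : x < suc (s + ν + 2)
  x<1+c = ℕ.≰⇒> (λ le → subst T eq (ℕ.≤⇒≤ᵇ le))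
  t≡s : s ⊔ height ν (indexFrom (suc (suc s)) xs) ≡ s
  t≡s = trans (cong (s ⊔_) (height-low ν (suc (suc s)) xs x≥ (ℕ.m<n⇒m<1+n x<1+c))) (ℕ.⊔-identityʳ s)
  low : x < s + ν + 2 → All (_< s + ν + 2) (x ∷ xs)
  low x<c = x<c ∷ All.map (λ y≤x → ℕ.≤-<-trans y≤x x<c) x≥
  to : All (Below ν (s ⊔ height ν (indexFrom (suc (suc s)) xs))) ((suc s , x) ∷ indexFrom (suc (suc s)) xs) →
       Avoid 1 (s + ν + 2) (x ∷ xs)
  to below with All.head (subst (λ t → All (Below ν t) ((suc s , x) ∷ indexFrom (suc (suc s)) xs)) t≡s below)
  ... | inj₁ s<s = contradiction s<s (ℕ.<-irrefl refl)
  ... | inj₂ x<c = all<⇒avoid 1 (low x<c)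
  from : Avoid 1 (s + ν + 2) (x ∷ xs) →
         All (Below ν (s ⊔ height ν (indexFrom (suc (suc s)) xs))) ((suc s , x) ∷ indexFrom (suc (suc s)) xs)
  from (x≢c , _) = subst (λ t → All (Below ν t) ((suc s , x) ∷ indexFrom (suc (suc s)) xs)) (sym t≡s)
    (All.map inj₂ (all-indexFrom (suc s) (low (ℕ.≤∧≢⇒< (ℕ.<⇒≤pred x<1+c) x≢c))))

durfeeT≡ : ∀ ν ls → durfeeT ν ls ≡ height ν (indexFrom 1 ls)
durfeeT≡ ν ls = trans (durfeeT≡height ν ls) (cong (height ν) (indexed≡indexFrom ls))

belowRect⇒avoid : ∀ ν {ls} → Desc ls → T (belowRect ν ls) → Avoid 1 (ν + 2) ls
belowRect⇒avoid ν {ls} desc below = proj₁ (below⇔avoid ν 0 ls desc)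
  (subst (λ t → All (Below ν t) (indexFrom 1 ls)) (durfeeT≡ ν ls)
    (subst (All (Below ν (durfeeT ν ls))) (indexed≡indexFrom ls) (All.map to (All.all⁺ _ (indexed ls) below))))
  where
  to : ∀ {il} → T (not (durfeeT ν ls <ᵇ proj₁ il) ∨ (proj₂ il <ᵇ durfeeT ν ls + ν + 2)) → Below ν (durfeeT ν ls) il
  to {i , l} p with Equivalence.to (T-∨ {not (durfeeT ν ls <ᵇ i)}) p
  ... | inj₂ lt = inj₂ (ℕ.<ᵇ⇒< _ _ lt)
  ... | inj₁ nlt = inj₁ (ℕ.≮⇒≥ (λ lt → subst T (Equivalence.to T-not-≡ nlt) (ℕ.<⇒<ᵇ lt)))

avoid⇒belowRect : ∀ ν {ls} → Desc ls → Avoid 1 (ν + 2) ls → T (belowRect ν ls)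
avoid⇒belowRect ν {ls} desc avoid = All.all⁻ _ (All.map from
  (subst (All (Below ν (durfeeT ν ls))) (sym (indexed≡indexFrom ls))
    (subst (λ t → All (Below ν t) (indexFrom 1 ls)) (sym (durfeeT≡ ν ls)) (proj₂ (below⇔avoid ν 0 ls desc) avoid))))
  where
  from : ∀ {il} → Below ν (durfeeT ν ls) il → T (not (durfeeT ν ls <ᵇ proj₁ il) ∨ (proj₂ il <ᵇ durfeeT ν ls + ν + 2))
  from {i , l} (inj₂ lt) = Equivalence.from (T-∨ {not (durfeeT ν ls <ᵇ i)}) (inj₂ (ℕ.<⇒<ᵇ lt))
  from {i , l} (inj₁ i≤t) with durfeeT ν ls <ᵇ i in eq
  ... | false = _
  ... | true  = contradiction (ℕ.<ᵇ⇒< (durfeeT ν ls) i (subst T (sym eq) _)) (ℕ.≤⇒≯ i≤t)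

-- The Durfee bijection

module Residue (a : ℕ) where

  A : Pred ℕ 0ℓ
  A x = T (x % 4 ≡ᵇ a)

  A? : Decidable A
  A? x = T? (x % 4 ≡ᵇ a)

  -- Members of one residue class differ by a multiple of 4.
  A-≤ : ∀ {x y} → A x → A y → x < 4 + y → x ≤ y
  A-≤ {x} {y} Ax Ay x<4+y = subst₂ _≤_ (sym x≡) (sym y≡)
    (ℕ.+-monoʳ-≤ a (ℕ.*-monoˡ-≤ 4 (ℕ.<⇒≤pred (ℕ.*-cancelʳ-< 4 (x / 4) (suc (y / 4)) (ℕ.+-cancelˡ-< a _ _ bound)))))
    where
    x≡ : x ≡ a + x / 4 * 4
    x≡ = trans (m≡m%n+[m/n]*n x 4) (cong (_+ x / 4 * 4) (ℕ.≡ᵇ⇒≡ (x % 4) a Ax))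
    y≡ : y ≡ a + y / 4 * 4
    y≡ = trans (m≡m%n+[m/n]*n y 4) (cong (_+ y / 4 * 4) (ℕ.≡ᵇ⇒≡ (y % 4) a Ay))
    lemma : ∀ a b → 4 + (a + b) ≡ a + (4 + b)
    lemma = ℕ-Solver.solve-∀
    bound : a + x / 4 * 4 < a + suc (y / 4) * 4
    bound = subst₂ _<_ x≡ (trans (cong (λ z → 4 + z) y≡) (lemma a (y / 4 * 4))) x<4+y

  module Shift (c₀ : ℕ) (Ac₀ : A c₀) where

    insert : List ℕ → List ℕ
    insert xs = sort (c₀ ∷ xs)

    -- `c` is the forbidden size of the current row, starting from `c₀`. Rows before the first hit
    -- gain one box, that is 4; the hit row is replaced by a part `c₀`.
    forward : ℕ → List ℕ → List ℕ
    forward c []       = []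
    forward c (x ∷ xs) with x ℕ.≟ c
    ... | yes _ = insert xs
    ... | no  _ = (4 + x) ∷ forward (4 + c) xs

    -- The bound 8 + c recognises the lengthened rows: before a hit a row is at least 4 + c, hence
    -- at least 8 + c after lengthening, while all rows after the hit are at most c.
    backward : ℕ → List ℕ → List ℕ
    backward c []       = []
    backward c (y ∷ ys) with 8 + c ℕ.≤? y
    ... | yes _ = (y ∸ 4) ∷ backward (4 + c) ys
    ... | no  _ = c ∷ delete c₀ (y ∷ ys)

    all-insert : ∀ {P : Pred ℕ 0ℓ} {xs} → P c₀ → All P xs → All P (insert xs)
    all-insert p ps = All-resp-↭ (↭-sym (sort-↭ _)) (p ∷ ps)

    delete-insert : ∀ {xs} → Desc xs → delete c₀ (insert xs) ≡ xs
    delete-insert {xs} desc = desc-↭⇒≡ (delete-desc (insert xs) (sort-desc _)) desc (∷-↭⇒delete-↭ (sort-↭ (c₀ ∷ xs)))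

    insert-delete : ∀ {xs} → Desc xs → c₀ ∈ xs → insert (delete c₀ xs) ≡ xs
    insert-delete desc c₀∈ = desc-↭⇒≡ (sort-desc _) desc (↭-trans (sort-↭ _) (delete-↭ c₀∈))

    hit⇒≤ : ∀ {c b xs} → ¬ Avoid 4 c xs → All (_≤ b) xs → c ≤ b
    hit⇒≤ hit xs≤b = ℕ.≮⇒≥ λ b<c → hit (all<⇒avoid 4 (All.map (λ x≤b → ℕ.≤-<-trans x≤b b<c) xs≤b))

    forward-hit : ∀ c xs → forward c (c ∷ xs) ≡ insert xs
    forward-hit c xs with c ℕ.≟ c
    ... | yes _   = refl
    ... | no  c≢c = contradiction refl c≢c

    forward-miss : ∀ {c x} xs → x ≢ c → forward c (x ∷ xs) ≡ (4 + x) ∷ forward (4 + c) xs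
    forward-miss {c} {x} xs x≢c with x ℕ.≟ c
    ... | yes x≡c = contradiction x≡c x≢c
    ... | no  _   = refl

    backward-high : ∀ {c y} ys → 8 + c ≤ y → backward c (y ∷ ys) ≡ (y ∸ 4) ∷ backward (4 + c) ys
    backward-high {c} {y} ys le with 8 + c ℕ.≤? y
    ... | yes _  = refl
    ... | no nle = contradiction le nle

    backward-low : ∀ {c ys} → c₀ ∈ ys → All (_≤ c) ys → backward c ys ≡ c ∷ delete c₀ ys
    backward-low {c} {y ∷ ys} _ (y≤c ∷ _) with 8 + c ℕ.≤? y
    ... | yes le = contradiction (ℕ.≤-trans le y≤c) (ℕ.<⇒≱ (ℕ.m≤n+m (suc c) 7))
    ... | no  _  = refl

    forward-≤ : ∀ {b} c xs → c₀ ≤ 4 + b → All (_≤ b) xs → All (_≤ 4 + b) (forward c xs)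
    forward-≤ c []       c₀≤ [] = []
    forward-≤ {b} c (x ∷ xs) c₀≤ (x≤b ∷ xs≤b) with x ℕ.≟ c
    ... | yes _ = all-insert c₀≤ (All.map (λ y≤b → ℕ.≤-trans y≤b (ℕ.m≤n+m b 4)) xs≤b)
    ... | no  _ = ℕ.+-monoʳ-≤ 4 x≤b ∷ forward-≤ (4 + c) xs c₀≤ xs≤b

    forward-A : ∀ c {xs} → All A xs → All A (forward c xs)
    forward-A c []         = []
    forward-A c {x ∷ xs} (px ∷ pxs) with x ℕ.≟ c
    ... | yes _ = all-insert Ac₀ pxs
    ... | no  _ = px ∷ forward-A (4 + c) pxs

    -- Before the hit, rows and forbidden sizes both move up by 4. After it, the rows are at most c
    -- and stay below every forbidden size.
    forward-avoid : ∀ {c xs} → c₀ ≤ c → Desc xs → Avoid 4 (4 + c) (forward c xs)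
    forward-avoid {c} {[]} _ _ = tt
    forward-avoid {c} {x ∷ xs} c₀≤c (x≥ ∷ desc) with x ℕ.≟ c
    ... | yes refl = all<⇒avoid 4 (All.map (λ y≤c → ℕ.≤-<-trans y≤c (ℕ.m≤n+m (suc c) 3)) (all-insert c₀≤c x≥))
    ... | no  x≢c  = x≢c ∘ ℕ.+-cancelˡ-≡ 4 x c , forward-avoid (ℕ.m≤n⇒m≤o+n 4 c₀≤c) desc

    record Hit (c : ℕ) (xs : List ℕ) : Set where
      constructor mkHit
      field
        c₀≤c : c₀ ≤ c
        desc : Desc xs
        hit  : ¬ Avoid 4 c xs

    -- The hit is now in a later row, whose forbidden size is at least 4 + c, and x is no smaller
    -- than that row.
    hit-tail : ∀ {c x xs} → x ≢ c → Hit c (x ∷ xs) → 4 + c ≤ x × Hit (4 + c) xs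
    hit-tail x≢c (mkHit c₀≤c (x≥ ∷ desc) hit) =
      hit⇒≤ hit′ x≥ , mkHit (ℕ.m≤n⇒m≤o+n 4 c₀≤c) desc hit′
      where hit′ = λ avoid → hit (x≢c , avoid)

    forward-desc : ∀ {c xs} → Hit c xs → Desc (forward c xs)
    forward-desc {xs = []} h = []
    forward-desc {c} {x ∷ xs} h with x ℕ.≟ c
    ... | yes _  = sort-desc _
    ... | no x≢c with hit-tail x≢c h
    ... | 4+c≤x , h′ = forward-≤ (4 + c) xs (ℕ.≤-trans (Hit.c₀≤c h′) (ℕ.m≤n⇒m≤o+n 4 4+c≤x)) (AllPairs.head (Hit.desc h))
                     ∷ forward-desc h′

    c₀∈forward : ∀ {c xs} → Hit c xs → c₀ ∈ forward c xs
    c₀∈forward {xs = []} h = contradiction tt (Hit.hit h)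
    c₀∈forward {c} {x ∷ xs} h with x ℕ.≟ c
    ... | yes _  = ∈-resp-↭ (↭-sym (sort-↭ _)) (here refl)
    ... | no x≢c = there (c₀∈forward (proj₂ (hit-tail x≢c h)))

    -- Each lengthened row adds 4, and the size of the row to be removed grows by 4 as well. At the
    -- start c = `c₀`, so the sum is preserved.
    sum-forward : ∀ {c xs} → Hit c xs → sum (forward c xs) + c ≡ sum xs + c₀
    sum-forward {xs = []} h = contradiction tt (Hit.hit h)
    sum-forward {c} {x ∷ xs} h with x ℕ.≟ c
    ... | yes refl = trans (cong (_+ x) (sum-↭ (sort-↭ (c₀ ∷ xs)))) (lemma c₀ (sum xs) x)
      where
      lemma : ∀ a b c → a + b + c ≡ c + b + a
      lemma = ℕ-Solver.solve-∀
    ... | no x≢c = trans (lemma x (sum (forward (4 + c) xs)) c)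
                         (trans (cong (x ℕ.+_) (sum-forward (proj₂ (hit-tail x≢c h)))) (sym (ℕ.+-assoc x (sum xs) c₀)))
      where
      lemma : ∀ x s c → 4 + x + s + c ≡ x + (s + (4 + c))
      lemma = ℕ-Solver.solve-∀

    -- Rows up to the hit are at least `c₀`, so smaller parts come after it and are untouched.
    ∈-forward : ∀ {c xs v} → Hit c xs → v < c₀ → v ∈ xs → v ∈ forward c xs
    ∈-forward {c} {x ∷ xs} h v<c₀ v∈ with x ℕ.≟ c
    ∈-forward h v<c₀ (here refl) | yes refl = contradiction (Hit.c₀≤c h) (ℕ.<⇒≱ v<c₀)
    ∈-forward h v<c₀ (there v∈)  | yes refl = ∈-resp-↭ (↭-sym (sort-↭ _)) (there v∈)
    ∈-forward h v<c₀ (here refl) | no x≢c = let (4+c≤x , h′) = hit-tail x≢c h in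
      contradiction (ℕ.≤-trans (Hit.c₀≤c h′) 4+c≤x) (ℕ.<⇒≱ v<c₀)
    ∈-forward h v<c₀ (there v∈)  | no x≢c = there (∈-forward (proj₂ (hit-tail x≢c h)) v<c₀ v∈)

    backward-forward : ∀ {c xs} → Hit c xs → backward c (forward c xs) ≡ xs
    backward-forward {xs = []} h = refl
    backward-forward {c} {x ∷ xs} h with x ℕ.≟ c
    ... | yes refl = trans (backward-low (∈-resp-↭ (↭-sym (sort-↭ _)) (here refl)) (all-insert (Hit.c₀≤c h) (AllPairs.head (Hit.desc h))))
                           (cong (x ∷_) (delete-insert (AllPairs.tail (Hit.desc h))))
    ... | no x≢c with hit-tail x≢c h
    ... | 4+c≤x , h′ = trans (backward-high _ (ℕ.+-monoʳ-≤ 4 4+c≤x)) (cong (x ∷_) (backward-forward h′))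

    record Miss (c : ℕ) (ys : List ℕ) : Set where
      constructor mkMiss
      field
        c₀≤c  : c₀ ≤ c
        Ac    : A c
        desc  : Desc ys
        allA  : All A ys
        c₀∈   : c₀ ∈ ys
        avoid : Avoid 4 (4 + c) ys

    data Step (c : ℕ) : List ℕ → Set where
      high : ∀ {y ys} → 8 + c ≤ 4 + y → Miss (4 + c) ys → Step c (4 + y ∷ ys)
      low  : ∀ {ys} → All (_≤ c) ys → Step c ys

    -- The first row differs from 4 + c and is congruent to c, so it is either at least 8 + c or at
    -- most c.
    step : ∀ {c ys} → Miss c ys → Step c ys
    step {c} {y ∷ ys} (mkMiss c₀≤c Ac (y≥ ∷ desc) (Ay ∷ allA) c₀∈ (y≢ , avoid)) with 8 + c ℕ.≤? y
    ... | yes le@(s≤s (s≤s (s≤s (s≤s _)))) = high le (mkMiss (ℕ.m≤n⇒m≤o+n 4 c₀≤c) Ac desc allA (c₀∈tail c₀∈) avoid)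
      where
      c₀∈tail : c₀ ∈ y ∷ ys → c₀ ∈ ys
      c₀∈tail (here refl) = contradiction (ℕ.≤-trans le c₀≤c) (ℕ.<⇒≱ (ℕ.m≤n+m (suc c) 7))
      c₀∈tail (there p)   = p
    ... | no nle = low (y≤c ∷ All.map (λ z≤y → ℕ.≤-trans z≤y y≤c) y≥)
      where
      y≤c : y ≤ c
      y≤c = A-≤ {y} {c} Ay Ac (ℕ.≤∧≢⇒< (A-≤ {y} {4 + c} Ay Ac (ℕ.≰⇒> nle)) y≢)

    backward-≤ : ∀ {b c ys} → Miss c ys → c ≤ b → All (_≤ 4 + b) ys → All (_≤ b) (backward c ys)
    backward-≤ {b} {c} {ys} m c≤b ys≤ with step m
    ... | low ys≤c = subst (All (_≤ b)) (sym (backward-low (Miss.c₀∈ m) ys≤c))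
                       (c≤b ∷ All-delete ys (All.map (λ y≤c → ℕ.≤-trans y≤c c≤b) ys≤c))
    backward-≤ {b} {c} {_ ∷ zs} m c≤b (y≤ ∷ ys≤) | high le m′ = subst (All (_≤ b)) (sym (backward-high zs le))
      (ℕ.+-cancelˡ-≤ 4 _ _ y≤ ∷ backward-≤ m′ (ℕ.+-cancelˡ-≤ 4 _ _ (ℕ.≤-trans le y≤)) ys≤)

    backward-desc : ∀ {c ys} → Miss c ys → Desc (backward c ys)
    backward-desc {c} {ys} m with step m
    ... | low ys≤c = subst Desc (sym (backward-low (Miss.c₀∈ m) ys≤c)) (All-delete ys ys≤c ∷ delete-desc ys (Miss.desc m))
    ... | high {ys = zs} le m′ = subst Desc (sym (backward-high zs le))
      (backward-≤ m′ (ℕ.+-cancelˡ-≤ 4 _ _ le) (AllPairs.head (Miss.desc m)) ∷ backward-desc m′)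

    backward-A : ∀ {c ys} → Miss c ys → All A (backward c ys)
    backward-A {c} {ys} m with step m
    ... | low ys≤c = subst (All A) (sym (backward-low (Miss.c₀∈ m) ys≤c)) (Miss.Ac m ∷ All-delete ys (Miss.allA m))
    ... | high {ys = zs} le m′ = subst (All A) (sym (backward-high zs le)) (All.head (Miss.allA m) ∷ backward-A m′)

    backward-hit : ∀ {c ys} → Miss c ys → ¬ Avoid 4 c (backward c ys)
    backward-hit {c} {ys} m with step m
    ... | low ys≤c = λ avoid → proj₁ (subst (Avoid 4 c) (backward-low (Miss.c₀∈ m) ys≤c) avoid) refl
    ... | high {ys = zs} le m′ = λ avoid → backward-hit m′ (proj₂ (subst (Avoid 4 c) (backward-high zs le) avoid))

    ∈-backward : ∀ {c ys v} → Miss c ys → v < c₀ → v ∈ ys → v ∈ backward c ys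
    ∈-backward {c} {ys} {v} m v<c₀ v∈ with step m
    ... | low ys≤c = subst (v ∈_) (sym (backward-low (Miss.c₀∈ m) ys≤c)) (there (v∈delete (∈-resp-↭ (↭-sym (delete-↭ (Miss.c₀∈ m))) v∈)))
      where
      v∈delete : v ∈ c₀ ∷ delete c₀ ys → v ∈ delete c₀ ys
      v∈delete (here refl) = contradiction v<c₀ (ℕ.<-irrefl refl)
      v∈delete (there p)   = p
    ∈-backward {c} {_} {v} m v<c₀ (here refl) | high le m′ =
      contradiction (ℕ.≤-trans (ℕ.m≤n⇒m≤o+n 4 (Miss.c₀≤c m′)) le) (ℕ.<⇒≱ v<c₀)
    ∈-backward {c} {_} {v} m v<c₀ (there v∈) | high {ys = zs} le m′ =
      subst (v ∈_) (sym (backward-high zs le)) (there (∈-backward m′ v<c₀ v∈))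

    forward-backward : ∀ {c ys} → Miss c ys → forward c (backward c ys) ≡ ys
    forward-backward {c} {ys} m with step m
    ... | low ys≤c = trans (cong (forward c) (backward-low (Miss.c₀∈ m) ys≤c))
      (trans (forward-hit c (delete c₀ ys)) (insert-delete (Miss.desc m) (Miss.c₀∈ m)))
    ... | high {y} {zs} le m′ = trans (cong (forward c) (backward-high zs le))
      (trans (forward-miss (backward (4 + c) zs) (ℕ.>⇒≢ (ℕ.<-≤-trans (ℕ.m≤n+m (suc c) 3) (ℕ.+-cancelˡ-≤ 4 _ _ le))))
        (cong (4 + y ∷_) (forward-backward m′)))

-- Acting on the parts of one residue class

filter-↭-split : ∀ {P : Pred ℕ 0ℓ} (P? : Decidable P) xs → filter P? xs ++ filter (¬? ∘ P?) xs ↭ xs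
filter-↭-split P? []       = ↭-refl
filter-↭-split P? (x ∷ xs) with does (P? x)
... | true  = prep x (filter-↭-split P? xs)
... | false = ↭-trans (Perm.shift x (filter P? xs) (filter (¬? ∘ P?) xs)) (prep x (filter-↭-split P? xs))

module _ {P : Pred ℕ 0ℓ} (P? : Decidable P) where

  replace : (List ℕ → List ℕ) → List ℕ → List ℕ
  replace φ xs = sort (φ (filter P? xs) ++ filter (¬? ∘ P?) xs)

  module Replacement (φ : List ℕ → List ℕ) {xs : List ℕ} (desc : Desc xs)
           (φ-desc : Desc (φ (filter P? xs))) (φ-P : All P (φ (filter P? xs))) where

    filter-replace : filter P? (replace φ xs) ≡ φ (filter P? xs)
    filter-replace = desc-↭⇒≡ (AllPairs.filter⁺ P? (sort-desc _)) φ-desc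
      (↭-trans (filter-↭ P? (sort-↭ _)) (↭-reflexive (trans (filter-++ P? (φ (filter P? xs)) _)
        (trans (cong₂ _++_ (filter-all P? φ-P) (filter-none P? (All.all-filter (¬? ∘ P?) xs))) (++-identityʳ _)))))

    filter-¬-replace : filter (¬? ∘ P?) (replace φ xs) ≡ filter (¬? ∘ P?) xs
    filter-¬-replace = desc-↭⇒≡ (AllPairs.filter⁺ (¬? ∘ P?) (sort-desc _)) (AllPairs.filter⁺ (¬? ∘ P?) desc)
      (↭-trans (filter-↭ (¬? ∘ P?) (sort-↭ _)) (↭-reflexive (trans (filter-++ (¬? ∘ P?) (φ (filter P? xs)) _)
        (cong₂ _++_ (filter-none (¬? ∘ P?) (All.map (λ p ¬p → ¬p p) φ-P))
                    (filter-all (¬? ∘ P?) (All.all-filter (¬? ∘ P?) xs))))))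

    replace-inverse : ∀ ψ → ψ (φ (filter P? xs)) ≡ filter P? xs → replace ψ (replace φ xs) ≡ xs
    replace-inverse ψ inv = desc-↭⇒≡ (sort-desc _) desc (↭-trans (sort-↭ _)
      (↭-trans (↭-reflexive (cong₂ _++_ (trans (cong ψ filter-replace) inv) filter-¬-replace)) (filter-↭-split P? xs)))

    sum-replace : sum (φ (filter P? xs)) ≡ sum (filter P? xs) → sum (replace φ xs) ≡ sum xs
    sum-replace eq = trans (sum-↭ (sort-↭ (φ (filter P? xs) ++ filter (¬? ∘ P?) xs)))
      (trans (sum-++ (φ (filter P? xs)) _) (trans (cong (_+ sum (filter (¬? ∘ P?) xs)) eq)
        (trans (sym (sum-++ (filter P? xs) _)) (sum-↭ (filter-↭-split P? xs)))))

    all-replace : ∀ {Q : Pred ℕ 0ℓ} → (∀ {x} → P x → Q x) → All Q xs → All Q (replace φ xs)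
    all-replace P⇒Q all = All-resp-↭ (↭-sym (sort-↭ _)) (All.++⁺ (All.map P⇒Q φ-P) (All.filter⁺ (¬? ∘ P?) all))

    ∈-replace : ∀ {v} → v ∈ φ (filter P? xs) → v ∈ replace φ xs
    ∈-replace v∈ = ∈-resp-↭ (↭-sym (sort-↭ _)) (∈-++⁺ˡ v∈)

module Durfee (a : ℕ) (Aa : T (a % 4 ≡ᵇ a)) (A⇒odd : ∀ {x} → T (x % 4 ≡ᵇ a) → Odd x) where

  open Residue a

  A-arith : ∀ j → A (a + 4 * j)
  A-arith j = subst (λ r → T (r ≡ᵇ a)) (sym (trans (cong (λ z → (a + z) % 4) (ℕ.*-comm 4 j)) ([m+kn]%n≡m%n a j 4))) Aa

  arith-suc : ∀ j → 4 + (a + 4 * j) ≡ a + 4 * suc j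
  arith-suc j = lemma a j
    where
    lemma : ∀ a j → 4 + (a + 4 * j) ≡ a + 4 * (1 + j)
    lemma = ℕ-Solver.solve-∀

  arith-< : ∀ {i j} → i < j → a + 4 * i < a + 4 * j
  arith-< i<j = ℕ.+-monoʳ-< a (ℕ.*-monoʳ-< 4 i<j)

  Contains : ℕ → Pred (List ℕ) 0ℓ
  Contains k xs = All Odd xs × (∀ {j} → j < k → a + 4 * j ∈ xs)

  contains? : ∀ k → Decidable (Contains k)
  contains? k xs = allOdd? xs ×-dec ℕ.allUpTo? (λ j → a + 4 * j ∈? xs) k

  AvoidA : ℕ → Pred (List ℕ) 0ℓ
  AvoidA k xs = Avoid 4 (a + 4 * k) (filter A? xs)

  avoidA? : ∀ k → Decidable (AvoidA k)
  avoidA? k xs = avoid? 4 (a + 4 * k) (filter A? xs)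

  -- The index k is the number of prescribed parts a, a + 4, ...; thus k = ν + 1 gives p_o(a,4,ν;N).
  truncated : ℕ → ℤ → ℕ
  truncated k = count (λ xs → contains? k xs ×-dec avoidA? k xs)

  -- `forward` acts on the parts congruent to a and leaves the others alone. The inserted `c₀` is
  -- the new prescribed part, and the smaller prescribed parts survive in both directions.
  count-hit : ∀ k N → count (λ xs → contains? k xs ×-dec ¬? (avoidA? k xs)) N ≡ truncated (suc k) N
  count-hit k N = count-bijection (λ xs → contains? k xs ×-dec ¬? (avoidA? k xs))
    (λ xs → contains? (suc k) xs ×-dec avoidA? (suc k) xs) (replace A? (forward c₀)) (replace A? (backward c₀)) to from
    where
    c₀ = a + 4 * k
    open Shift c₀ (A-arith k)
    small : ∀ {j} → j < suc k → j ≢ k → a + 4 * j < c₀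
    small j<1+k j≢k = arith-< (ℕ.≤∧≢⇒< (ℕ.<⇒≤pred j<1+k) j≢k)
    to : ∀ {xs} → IsPartition N xs → Contains k xs × ¬ AvoidA k xs →
         IsPartition N (replace A? (forward c₀) xs) ×
         (Contains (suc k) (replace A? (forward c₀) xs) × AvoidA (suc k) (replace A? (forward c₀) xs)) ×
         replace A? (backward c₀) (replace A? (forward c₀) xs) ≡ xs
    to {xs} (desc , pos , s) ((odds , cont) , hit) =
      (sort-desc _ , All.map (λ {x} → odd⇒pos {x}) odds′ , trans (cong +_ (sum-replace sum-eq)) s)
      , ((odds′ , contains) , subst₂ (Avoid 4) (arith-suc k) (sym filter-replace) (forward-avoid ℕ.≤-refl (Hit.desc h)))
      , replace-inverse (backward c₀) (backward-forward h)
      where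
      h : Hit c₀ (filter A? xs)
      h = mkHit ℕ.≤-refl (AllPairs.filter⁺ A? desc) hit
      φ-desc = forward-desc h
      φ-A = forward-A c₀ (All.all-filter A? xs)
      open Replacement A? (forward c₀) desc φ-desc φ-A
      sum-eq : sum (forward c₀ (filter A? xs)) ≡ sum (filter A? xs)
      sum-eq = ℕ.+-cancelʳ-≡ c₀ _ _ (sum-forward h)
      odds′ = all-replace (λ {x} → A⇒odd {x}) odds
      contains : ∀ {j} → j < suc k → a + 4 * j ∈ replace A? (forward c₀) xs
      contains {j} j<1+k with j ℕ.≟ k
      ... | yes refl = ∈-replace (c₀∈forward h)
      ... | no  j≢k  = ∈-replace (∈-forward h (small j<1+k j≢k)
        (∈-filter⁺ A? (cont (ℕ.≤∧≢⇒< (ℕ.<⇒≤pred j<1+k) j≢k)) (A-arith j)))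
    from : ∀ {xs} → IsPartition N xs → Contains (suc k) xs × AvoidA (suc k) xs →
         IsPartition N (replace A? (backward c₀) xs) ×
         (Contains k (replace A? (backward c₀) xs) × ¬ AvoidA k (replace A? (backward c₀) xs)) ×
         replace A? (forward c₀) (replace A? (backward c₀) xs) ≡ xs
    from {xs} (desc , pos , s) ((odds , cont) , avoid) =
      (sort-desc _ , All.map (λ {x} → odd⇒pos {x}) odds′ , trans (cong +_ (sum-replace sum-eq)) s)
      , ((odds′ , λ {j} j<k → ∈-replace (∈-backward m (arith-< j<k)
            (∈-filter⁺ A? (cont (ℕ.m<n⇒m<1+n j<k)) (A-arith j))))
        , subst (λ ys → ¬ Avoid 4 c₀ ys) (sym filter-replace) (backward-hit m))
      , replace-inverse (forward c₀) (forward-backward m)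
      where
      m : Miss c₀ (filter A? xs)
      m = mkMiss ℕ.≤-refl (A-arith k) (AllPairs.filter⁺ A? desc) (All.all-filter A? xs)
            (∈-filter⁺ A? (cont ℕ.≤-refl) (A-arith k)) (subst (λ c → Avoid 4 c (filter A? xs)) (sym (arith-suc k)) avoid)
      φ-desc = backward-desc m
      φ-A = backward-A m
      open Replacement A? (backward c₀) desc φ-desc φ-A
      -- `forward` preserves the sum and undoes `backward`, so `backward` preserves it too.
      sum-eq : sum (backward c₀ (filter A? xs)) ≡ sum (filter A? xs)
      sum-eq = sym (ℕ.+-cancelʳ-≡ c₀ _ _ (trans (cong (λ ys → sum ys + c₀) (sym (forward-backward m)))
        (sum-forward (mkHit ℕ.≤-refl φ-desc (backward-hit m)))))
      odds′ = all-replace (λ {x} → A⇒odd {x}) odds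

  staircase : ℕ → ℤ
  staircase zero    = + 0
  staircase (suc k) = + (a + 4 * k) ℤ.+ staircase k

  -- Removing one copy of each prescribed part, the largest first, leaves an arbitrary partition
  -- into odd parts.
  count-contains : ∀ k N → count (contains? k) N ≡ oddCount (N ℤ.- staircase k)
  count-contains zero    N = trans (count-cong (contains? 0) allOdd? {N} (λ _ → proj₁) (λ _ odds → odds , λ ()))
                                   (cong oddCount (sym (ℤ.+-identityʳ N)))
  count-contains (suc k) N = trans
    (count-remove-part (contains? (suc k)) (contains? k) {s} {N} (odd⇒pos {s} (A⇒odd {s} (A-arith k)))
      contains-↭ contains-↭ (λ { (_ , cont) → cont ℕ.≤-refl })
      (λ { (_ ∷ odds , cont) → odds , λ j<k → tail j<k (cont (ℕ.m<n⇒m<1+n j<k)) })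
      (λ { {xs} (odds , cont) → A⇒odd {s} (A-arith k) ∷ odds , λ {j} → cons cont j }))
    (trans (count-contains k (N ℤ.- + s)) (cong oddCount (lemma N (+ s) (staircase k))))
    where
    s = a + 4 * k
    lemma : ∀ N s t → N ℤ.- s ℤ.- t ≡ N ℤ.- (s ℤ.+ t)
    lemma = solve-∀
    contains-↭ : ∀ {k xs ys} → xs ↭ ys → Contains k xs → Contains k ys
    contains-↭ p (odds , cont) = All-resp-↭ p odds , λ j<k → ∈-resp-↭ p (cont j<k)
    tail : ∀ {j xs} → j < k → a + 4 * j ∈ s ∷ xs → a + 4 * j ∈ xs
    tail j<k (here eq) = contradiction eq (ℕ.<⇒≢ (arith-< j<k))
    tail j<k (there p) = p
    cons : ∀ {xs} → (∀ {j} → j < k → a + 4 * j ∈ xs) → ∀ j → j < suc k → a + 4 * j ∈ s ∷ xs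
    cons cont j j<1+k with j ℕ.≟ k
    ... | yes refl = here refl
    ... | no  j≢k  = there (cont (ℕ.≤∧≢⇒< (ℕ.<⇒≤pred j<1+k) j≢k))

  -- Split the partitions with k prescribed parts by whether some row hits its forbidden size;
  -- `count-hit` moves those with a hit to index k + 1.
  truncated-recurrence : ∀ k N → truncated k N + truncated (suc k) N ≡ oddCount (N ℤ.- staircase k)
  truncated-recurrence k N = trans (cong (truncated k N ℕ.+_) (sym (count-hit k N)))
    (trans (sym (count-split (contains? k) (avoidA? k) N)) (count-contains k N))

  -- Comparison with the definition of p_o(a,4,ν;n)

  A-decompose : ∀ {x} → A x → x ≡ a + 4 * (x / 4)
  A-decompose {x} Ax = trans (m≡m%n+[m/n]*n x 4) (cong₂ _+_ (ℕ.≡ᵇ⇒≡ (x % 4) a Ax) (ℕ.*-comm (x / 4) 4))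

  ell-arith : ∀ k → ell a 4 (a + 4 * k) ≡ suc k
  ell-arith k = trans (cong (λ z → z / 4 + 1) (trans (ℕ.m+n∸m≡n a (4 * k)) (ℕ.*-comm 4 k)))
    (trans (cong (_+ 1) (m*n/n≡m k 4)) (ℕ.+-comm k 1))

  -- On the residue class `ell` is injective and sends a + 4c to c + 1, so one box more is a step of
  -- 4 in size.
  avoid-ell⇒ : ∀ c {xs} → All A xs → Avoid 1 (suc c) (map (ell a 4) xs) → Avoid 4 (a + 4 * c) xs
  avoid-ell⇒ c []         _ = tt
  avoid-ell⇒ c {x ∷ xs} (_ ∷ pxs) (ne , avoid) =
    (λ { refl → ne (ell-arith c) }) , subst (λ d → Avoid 4 d xs) (sym (arith-suc c)) (avoid-ell⇒ (suc c) pxs avoid)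

  avoid-ell⇐ : ∀ c {xs} → All A xs → Avoid 4 (a + 4 * c) xs → Avoid 1 (suc c) (map (ell a 4) xs)
  avoid-ell⇐ c []         _ = tt
  avoid-ell⇐ c {x ∷ xs} (px ∷ pxs) (ne , avoid) =
    (λ eq → ne (trans x≡ (cong (λ k → a + 4 * k) (ℕ.suc-injective (trans (sym (ell-arith (x / 4))) (trans (cong (ell a 4) (sym x≡)) eq))))))
    , avoid-ell⇐ (suc c) pxs (subst (λ d → Avoid 4 d xs) (arith-suc c) avoid)
    where x≡ = A-decompose {x} px

  ell-desc : ∀ {xs} → Desc xs → Desc (map (ell a 4) xs)
  ell-desc desc = AllPairs.map⁺ (AllPairs.map (λ x≥y → ℕ.+-monoˡ-≤ 1 (/-monoˡ-≤ 4 (ℕ.∸-monoˡ-≤ a x≥y))) desc)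

  isPo⇒ : ∀ ν {xs} → Desc xs → T (isPo a ν xs) → Contains (suc ν) xs × AvoidA (suc ν) xs
  isPo⇒ ν {xs} desc p =
    let (odds , q)       = Equivalence.to (T-∧ {allOdd xs}) p
        (_ , r)          = Equivalence.to (T-∧ {allCong a 4 (filter A? xs)}) q
        (present , rect) = Equivalence.to T-∧ r
    in (All.all⁺ isOdd xs odds
       , λ {j} j<k → proj₁ (∈-filter⁻ A? (Any.map (λ {y} → ℕ.≡ᵇ⇒≡ (a + 4 * j) y)
           (Any.any⁻ _ (filter A? xs) (All.lookup (All.all⁺ _ (upTo (suc ν)) present) (∈-upTo⁺ j<k))))))
       , avoid-ell⇒ (suc ν) (All.all-filter A? xs)
           (subst (λ c → Avoid 1 c (map (ell a 4) (filter A? xs))) (ℕ.+-comm ν 2)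
             (belowRect⇒avoid ν (ell-desc (AllPairs.filter⁺ A? desc)) rect))

  isPo⇐ : ∀ ν {xs} → Desc xs → Contains (suc ν) xs × AvoidA (suc ν) xs → T (isPo a ν xs)
  isPo⇐ ν {xs} desc ((odds , cont) , avoid) =
    Equivalence.from (T-∧ {allOdd xs}) (All.all⁻ isOdd odds , Equivalence.from (T-∧ {allCong a 4 (filter A? xs)})
      ( All.all⁻ _ (All.map (λ {x} → cong-A {x}) (All.all-filter A? xs))
      , Equivalence.from T-∧
        ( All.all⁻ _ (All.tabulate λ {j} j∈ → Any.any⁺ _ (Any.map (λ {y} → ℕ.≡⇒≡ᵇ (a + 4 * j) y)
            (∈-filter⁺ A? (cont (∈-upTo⁻ j∈)) (A-arith j))))
        , avoid⇒belowRect ν (ell-desc (AllPairs.filter⁺ A? desc))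
            (subst (λ c → Avoid 1 c (map (ell a 4) (filter A? xs))) (ℕ.+-comm 2 ν)
              (avoid-ell⇐ (suc ν) (All.all-filter A? xs) avoid)))))
    where
    cong-A : ∀ {x} → A x → T (x % 4 ≡ᵇ a % 4)
    cong-A {x} Ax = subst (λ r → T (x % 4 ≡ᵇ r)) (sym (ℕ.≡ᵇ⇒≡ (a % 4) a Aa)) Ax

  p-o-a≡truncated : ∀ ν n → p-o-a a ν n ≡ truncated (suc ν) (+ n)
  p-o-a≡truncated ν n = count-cong (λ xs → T? (isPo a ν xs)) (λ xs → contains? (suc ν) xs ×-dec avoidA? (suc ν) xs) {+ n}
    (λ { (desc , _) → isPo⇒ ν desc }) (λ { (desc , _) → isPo⇐ ν desc })

-- Truncated sums

residue-1⇒odd : ∀ x → T (x % 4 ≡ᵇ 1) → Odd x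
residue-1⇒odd 1 _ = _
residue-1⇒odd (suc (suc (suc (suc x)))) p = residue-1⇒odd x p

residue-3⇒odd : ∀ x → T (x % 4 ≡ᵇ 3) → Odd x
residue-3⇒odd 3 _ = _
residue-3⇒odd (suc (suc (suc (suc x)))) p = residue-3⇒odd x p

module D₁ = Durfee 1 _ (λ {x} → residue-1⇒odd x)
module D₃ = Durfee 3 _ (λ {x} → residue-3⇒odd x)

-- The sums 3 + 7 + ... are the numbers j(2j + 1) with j ≥ 0, and the sums 1 + 5 + ... are those
-- with j < 0. The residues 3 and 1 together thus cover all integers j.
staircase₃ : ∀ k → D₃.staircase k ≡ hexagonal (+ k)
staircase₃ zero    = refl
staircase₃ (suc k) = trans (cong₂ (λ x y → + 3 ℤ.+ x ℤ.+ y) (ℤ.pos-* 4 k) (staircase₃ k)) (lemma (+ k) (+ triangle k))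
  where
  lemma : ∀ k t → (+ 3 ℤ.+ + 4 ℤ.* k) ℤ.+ (+ 4 ℤ.* t ℤ.- k) ≡ + 4 ℤ.* (t ℤ.+ (+ 1 ℤ.+ k)) ℤ.- (+ 1 ℤ.+ k)
  lemma = solve-∀

staircase₁ : ∀ k → D₁.staircase (suc k) ≡ hexagonal -[1+ k ]
staircase₁ zero    = refl
staircase₁ (suc k) = trans (cong₂ (λ x y → + 1 ℤ.+ x ℤ.+ y) (ℤ.pos-* 4 (suc k)) (staircase₁ k)) (lemma (+ k) (+ triangle k))
  where
  lemma : ∀ k t → (+ 1 ℤ.+ + 4 ℤ.* (+ 1 ℤ.+ k)) ℤ.+ (+ 4 ℤ.* t ℤ.+ (+ 1 ℤ.+ k))
        ≡ + 4 ℤ.* (t ℤ.+ (+ 1 ℤ.+ k)) ℤ.+ (+ 2 ℤ.+ k)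
  lemma = solve-∀

2*triangle : ∀ i → 2 * triangle i ≡ i * (i + 1)
2*triangle zero    = refl
2*triangle (suc i) = trans (ℕ.*-distribˡ-+ 2 (triangle i) (suc i)) (trans (cong (_+ 2 * suc i) (2*triangle i)) (lemma i))
  where
  lemma : ∀ i → i * (i + 1) + 2 * (1 + i) ≡ (1 + i) * (1 + i + 1)
  lemma = ℕ-Solver.solve-∀

4*tri : ∀ i → + 4 ℤ.* + triangle i ≡ + (2 * (i * (i + 1)))
4*tri i = trans (sym (ℤ.pos-* 4 (triangle i))) (cong +_ (trans (lemma (triangle i)) (cong (2 *_) (2*triangle i))))
  where
  lemma : ∀ t → 4 * t ≡ 2 * (2 * t)
  lemma = ℕ-Solver.solve-∀

hexagonal-pos : ∀ i → hexagonal (+ i) ≡ + (i * (2 * i + 1))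
hexagonal-pos i = trans (cong (ℤ._- + i) (trans (4*tri i) (cong +_ (lemma i)))) (cancel (+ (i * (2 * i + 1))) (+ i))
  where
  lemma : ∀ i → 2 * (i * (i + 1)) ≡ i * (2 * i + 1) + i
  lemma = ℕ-Solver.solve-∀
  cancel : ∀ a b → (a ℤ.+ b) ℤ.- b ≡ a
  cancel = solve-∀

hexagonal-neg : ∀ i → hexagonal -[1+ i ] ≡ + ((i + 1) * (2 * i + 1))
hexagonal-neg i = trans (cong (ℤ._+ + suc i) (4*tri i)) (cong +_ (lemma i))
  where
  lemma : ∀ i → 2 * (i * (i + 1)) + (1 + i) ≡ (i + 1) * (2 * i + 1)
  lemma = ℕ-Solver.solve-∀

tri≤hexagonal : ∀ j → + tri j ℤ.≤ hexagonal j
tri≤hexagonal j = subst₂ ℤ._≤_ (lemma (+ tri j) j) (lemma′ (+ tri j) j) (ℤ.+-monoʳ-≤ (+ tri j ℤ.- j) (j≤3tri j))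
  where
  lemma : ∀ t j → t ℤ.- j ℤ.+ j ≡ t
  lemma = solve-∀
  lemma′ : ∀ t j → t ℤ.- j ℤ.+ + 3 ℤ.* t ≡ + 4 ℤ.* t ℤ.- j
  lemma′ = solve-∀

oddCount-negative : ∀ {z} → z ℤ.< + 0 → oddCount z ≡ 0
oddCount-negative { -[1+ _ ]} _ = refl
oddCount-negative {+ _} (ℤ.+<+ ())

sgn-square : ∀ k → sgn k ℤ.* sgn k ≡ + 1
sgn-square zero    = refl
sgn-square (suc k) = trans (lemma (sgn k)) (sgn-square k)
  where
  lemma : ∀ s → (ℤ.- s) ℤ.* (ℤ.- s) ≡ s ℤ.* s
  lemma = solve-∀

p-o≡oddCount : ∀ n → p-o n ≡ oddCount (+ n)
p-o≡oddCount n = count-cong (λ xs → T? (allOdd xs)) allOdd? {+ n}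
  (λ {xs} _ → All.all⁺ isOdd xs) (λ _ → All.all⁻ isOdd)

module Truncation (N : ℕ) (odd : Odd N) where

  p : ℤ → ℤ
  p j = + oddCount (+ N ℤ.- hexagonal j)

  p-vanishes : ∀ j → N < tri j → p j ≡ + 0
  p-vanishes j N<tri = cong +_ (oddCount-negative (subst (+ N ℤ.- hexagonal j ℤ.<_) (ℤ.+-inverseʳ (hexagonal j))
    (ℤ.+-monoˡ-< (ℤ.- hexagonal j) (ℤ.<-≤-trans (ℤ.+<+ N<tri) (tri≤hexagonal j)))))

  -- Here ν = μ + 1, so the upper limit ν - 1 of the second sum is μ, and in `rhs` the index 2 + μ
  -- is ν + 1.
  lhs : ℕ → ℤ
  lhs μ = sgn (suc μ) ℤ.* (sumℤ (suc μ) (λ τ → sgn τ ℤ.* p (+ τ)) ℤ.- sumℤ μ (λ τ → sgn τ ℤ.* p -[1+ τ ]))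

  rhs : ℕ → ℤ
  rhs μ = + (D₃.truncated (2 + μ) (+ N) + D₁.truncated (2 + μ) (+ N))

  -- Consecutive values carry opposite outer signs, so the common summands cancel. The two new
  -- summands remain, each with sign +1.
  lhs-recurrence : ∀ μ → lhs μ ℤ.+ lhs (suc μ) ≡ p (+ (2 + μ)) ℤ.+ p -[1+ suc μ ]
  lhs-recurrence μ = trans
    (lemma (sgn μ) (sumℤ (suc μ) (λ τ → sgn τ ℤ.* p (+ τ))) (sumℤ μ (λ τ → sgn τ ℤ.* p -[1+ τ ])) (p (+ (2 + μ))) (p -[1+ suc μ ]))
    (trans (cong (ℤ._* (p (+ (2 + μ)) ℤ.+ p -[1+ suc μ ])) (sgn-square μ)) (ℤ.*-identityˡ _))
    where
    lemma : ∀ s a b x y → (ℤ.- s) ℤ.* (a ℤ.- b) ℤ.+ (ℤ.- (ℤ.- s)) ℤ.* ((a ℤ.+ (ℤ.- (ℤ.- s)) ℤ.* x) ℤ.- (b ℤ.+ (ℤ.- s) ℤ.* y))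
          ≡ (s ℤ.* s) ℤ.* (x ℤ.+ y)
    lemma = solve-∀

  truncated₃ : ∀ k → + (D₃.truncated k (+ N) + D₃.truncated (suc k) (+ N)) ≡ p (+ k)
  truncated₃ k = cong +_ (trans (D₃.truncated-recurrence k (+ N)) (cong (λ z → oddCount (+ N ℤ.- z)) (staircase₃ k)))

  truncated₁ : ∀ k → + (D₁.truncated (suc k) (+ N) + D₁.truncated (2 + k) (+ N)) ≡ p -[1+ k ]
  truncated₁ k = cong +_ (trans (D₁.truncated-recurrence (suc k) (+ N)) (cong (λ z → oddCount (+ N ℤ.- z)) (staircase₁ k)))

  rhs-recurrence : ∀ μ → rhs μ ℤ.+ rhs (suc μ) ≡ p (+ (2 + μ)) ℤ.+ p -[1+ suc μ ]
  rhs-recurrence μ = trans (cong +_ (lemma (D₃.truncated (2 + μ) (+ N)) _ (D₃.truncated (3 + μ) (+ N)) _))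
    (cong₂ ℤ._+_ (truncated₃ (2 + μ)) (truncated₁ (suc μ)))
    where
    lemma : ∀ a b c d → (a + b) + (c + d) ≡ (a + c) + (b + d)
    lemma = ℕ-Solver.solve-∀

  -- The bracket is the alternating sum over -J - 1 ≤ j ≤ J without its term at j = -J - 1. That
  -- term has a negative size, and the whole sum is zero for odd N.
  lhs-vanishes : ∀ μ → N ≤ μ → lhs μ ≡ + 0
  lhs-vanishes μ N≤μ = trans (cong (sgn (suc μ) ℤ.*_) inner) (ℤ.*-zeroʳ (sgn (suc μ)))
    where
    J = suc μ
    N<TJ : N < triangle J
    N<TJ = ℕ.≤-trans (s≤s N≤μ) (n≤triangle J)
    S⁺ = sumℤ J (λ τ → sgn τ ℤ.* p (+ τ))
    S⁻ = sumℤ μ (λ τ → sgn τ ℤ.* p -[1+ τ ])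
    split : ∀ J → altsum J p ≡ sumℤ J (λ τ → sgn τ ℤ.* p (+ τ)) ℤ.- sumℤ J (λ τ → sgn τ ℤ.* p -[1+ τ ])
    split zero    = lemma (p (+ 0)) (p -[1+ 0 ])
      where
      lemma : ∀ a b → + 1 ℤ.* (a ℤ.- b) ≡ + 1 ℤ.* a ℤ.- + 1 ℤ.* b
      lemma = solve-∀
    split (suc J) = trans (cong (ℤ._+ sgn (suc J) ℤ.* (p (+ suc J) ℤ.- p -[1+ suc J ])) (split J))
      (lemma (sumℤ J (λ τ → sgn τ ℤ.* p (+ τ))) (sumℤ J (λ τ → sgn τ ℤ.* p -[1+ τ ])) (sgn (suc J)) (p (+ suc J)) (p -[1+ suc J ]))
      where
      lemma : ∀ a b s x y → (a ℤ.- b) ℤ.+ s ℤ.* (x ℤ.- y) ≡ (a ℤ.+ s ℤ.* x) ℤ.- (b ℤ.+ s ℤ.* y)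
      lemma = solve-∀
    last : S⁻ ℤ.+ sgn J ℤ.* p -[1+ J ] ≡ S⁻
    last = trans (cong (λ z → S⁻ ℤ.+ sgn J ℤ.* z) (p-vanishes -[1+ J ] N<TJ))
      (trans (cong (λ z → S⁻ ℤ.+ z) (ℤ.*-zeroʳ (sgn J))) (ℤ.+-identityʳ S⁻))
    inner : S⁺ ℤ.- S⁻ ≡ + 0
    inner = trans (cong (λ z → S⁺ ℤ.- z) (sym last)) (trans (sym (split J)) (oddCount-altsum J odd N<TJ))

  -- By its recurrence each truncated count is one of two summands of a number `p j`, which is zero
  -- once the size is negative.
  rhs-vanishes : ∀ μ → N ≤ μ → rhs μ ≡ + 0
  rhs-vanishes μ N≤μ = cong +_ (cong₂ _+_
    (ℕ.m+n≡0⇒m≡0 (D₃.truncated (2 + μ) (+ N)) (ℤ.+-injective (trans (truncated₃ (2 + μ)) (p-vanishes (+ (2 + μ)) N<T₃))))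
    (ℕ.m+n≡0⇒m≡0 (D₁.truncated (2 + μ) (+ N)) (ℤ.+-injective (trans (truncated₁ (suc μ)) (p-vanishes -[1+ suc μ ] N<T₁)))))
    where
    N<T₁ : N < triangle (suc μ)
    N<T₁ = ℕ.≤-trans (s≤s N≤μ) (n≤triangle (suc μ))
    N<T₃ : N < triangle (2 + μ)
    N<T₃ = ℕ.≤-trans (ℕ.m≤n⇒m≤1+n (s≤s N≤μ)) (n≤triangle (2 + μ))

  -- Both sides satisfy the same recurrence for the sum of two neighbours, so equality passes from μ
  -- + 1 down to μ.
  descend : ∀ d μ → lhs (d + μ) ≡ rhs (d + μ) → lhs μ ≡ rhs μ
  descend zero    μ eq = eq
  descend (suc d) μ eq = descend d μ (+-cancelʳ (lhs (suc d + μ)) _ _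
    (trans (lhs-recurrence (d + μ)) (trans (sym (rhs-recurrence (d + μ))) (cong (λ z → rhs (d + μ) ℤ.+ z) (sym eq)))))

  lhs≡rhs : ∀ μ → lhs μ ≡ rhs μ
  lhs≡rhs μ = descend N μ (trans (lhs-vanishes (N + μ) (ℕ.m≤m+n N μ)) (sym (rhs-vanishes (N + μ) (ℕ.m≤m+n N μ))))

odd-2n+1 : ∀ n → Odd (2 * n + 1)
odd-2n+1 n = subst (λ r → T (r ≡ᵇ 1)) (sym (trans (cong (_% 2) (lemma n)) ([m+kn]%n≡m%n 1 n 2))) _
  where
  lemma : ∀ n → 2 * n + 1 ≡ 1 + n * 2
  lemma = ℕ-Solver.solve-∀

theorem1p5 : (ν n : ℕ) → ν ≥ 1 → ν * (2 * ν + 3) < n →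
    sgn ν ℤ.* ( sumℤ ν (λ τ → sgn τ ℤ.* ℤ.+ p-o (2 * n + 1 ∸ τ * (2 * τ + 1)))
    ℤ.- sumℤ (ν ∸ 1) (λ τ → sgn τ ℤ.* ℤ.+ p-o (2 * n + 1 ∸ (τ + 1) * (2 * τ + 1))) )
    ≡ ℤ.+ (p-o-a 3 ν (2 * n + 1) + p-o-a 1 ν (2 * n + 1))
theorem1p5 (suc μ) n _ bound = begin
  sgn ν ℤ.* ( sumℤ ν (λ τ → sgn τ ℤ.* + p-o (N ∸ τ * (2 * τ + 1)))
    ℤ.- sumℤ μ (λ τ → sgn τ ℤ.* + p-o (N ∸ (τ + 1) * (2 * τ + 1))))
    ≡⟨ cong₂ (λ x y → sgn ν ℤ.* (x ℤ.- y))
         (sumℤ-cong ν (λ τ τ≤ν → cong (sgn τ ℤ.*_) (term (+ τ) (hexagonal-pos τ) (≤N (ℕ.*-mono-≤ τ≤ν (2τ+1≤ τ≤ν))))))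
         (sumℤ-cong μ (λ τ τ≤μ → cong (sgn τ ℤ.*_) (term -[1+ τ ] (hexagonal-neg τ)
           (≤N (ℕ.*-mono-≤ (subst (_≤ ν) (ℕ.+-comm 1 τ) (s≤s τ≤μ)) (2τ+1≤ (ℕ.m≤n⇒m≤1+n τ≤μ))))))) ⟩
  lhs μ
    ≡⟨ lhs≡rhs μ ⟩
  rhs μ
    ≡⟨ sym (cong +_ (cong₂ _+_ (D₃.p-o-a≡truncated ν N) (D₁.p-o-a≡truncated ν N))) ⟩
  + (p-o-a 3 ν N + p-o-a 1 ν N) ∎
  where
  open ≡-Reasoning
  ν = suc μ
  N = 2 * n + 1
  open Truncation N (odd-2n+1 n)
  2τ+1≤ : ∀ {τ} → τ ≤ ν → 2 * τ + 1 ≤ 2 * ν + 3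
  2τ+1≤ τ≤ν = ℕ.+-mono-≤ (ℕ.*-monoʳ-≤ 2 τ≤ν) (s≤s z≤n)
  -- Every subtracted number is at most ν(2ν + 3) < n ≤ N, so `∸` agrees with subtraction in ℤ.
  ≤N : ∀ {m} → m ≤ ν * (2 * ν + 3) → m ≤ N
  ≤N m≤ = ℕ.≤-trans m≤ (ℕ.≤-trans (ℕ.<⇒≤ bound) (ℕ.≤-trans (ℕ.m≤n*m n 2) (ℕ.m≤m+n (2 * n) 1)))
  term : ∀ j {m} → hexagonal j ≡ + m → m ≤ N → + p-o (N ∸ m) ≡ p j
  term j {m} hex≡ m≤N = cong +_ (trans (p-o≡oddCount (N ∸ m)) (cong oddCount
    (trans (sym (ℤ.⊖-≥ m≤N)) (trans (sym (ℤ.m-n≡m⊖n N m)) (cong (λ z → + N ℤ.- z) (sym hex≡))))))
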